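{- As formal power series in $q$ with integer coefficients, the following congruence holds coefficientwise modulo $5$: \begin{align*} \sum_{n=0}^\infty \bar{p}(40n+35)q^n \equiv{}& 2\frac{f_2^{122}}{f_1^{63}f_4^{40}} +3 \frac{f_1f_2^{26}}{f_4^8} +4q\frac{f_2^{98}}{f_1^{55}f_4^{24}} +3qf_1^9f_2^2f_4^8 +4q^2\frac{f_2^{74}}{f_1^{47}f_4^8}\\ & +4q^3\frac{f_2^{50}f_4^8}{f_1^{39}} +4q^4\frac{f_2^{26}f_4^{24}}{f_1^{31}} + 2q^{5} \frac{f_2^2f_4^{40}}{f_1^{23}}\pmod{5}. \end{align*}
   Context: For a positive integer $n$, $f_n=(q^n;q^n)_\infty=\prod_{k=1}^\infty(1-q^{nk})$. An overpartition of a positive integer $n$ is a partition of $n$ in which the first occurrence of each distinct part may be overlined; $\bar{p}(n)$ denotes the number of overpartitions of $n$ for $n\ge1$, and $\bar{p}(0)=1$, so that $\sum_{n\ge0}\bar p(n)q^n=f_2/f_1^2$. -}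

module Defs where

open import Data.Nat as ℕ using (ℕ; zero; suc)
open import Data.Nat.Divisibility using (_∣?_)
open import Data.Integer using (ℤ; +_; _+_; _-_; _*_; -_)
open import Relation.Nullary.Decidable using (does)
open import Data.Bool using (if_then_else_)

Series : Set
Series = ℕ → ℤ

sumTo : ℕ → (ℕ → ℤ) → ℤ
sumTo zero    g = g 0
sumTo (suc n) g = sumTo n g + g (suc n)

infixl 7 _⊛_
_⊛_ : Series → Series → Series
(a ⊛ b) n = sumTo n (λ i → a i * b (n ℕ.∸ i))

one : Series
one zero    = + 1
one (suc _) = + 0

mono : ℕ → Series
mono j n = if does (n ℕ.≟ j) then + 1 else + 0

scale : ℤ → Series → Series
scale c s n = c * s n

shift : ℕ → Series → Series
shift a s n = if does (a ℕ.≤? n) then s (n ℕ.∸ a) else + 0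

pow : Series → ℕ → Series
pow s zero    = one
pow s (suc e) = s ⊛ pow s e

oneMinus : ℕ → Series
oneMinus j n = one n - mono j n

-- the series 1/(1 - q^j) = Σ_t q^{j t}  (used only with j ≥ 1)
geomInv : ℕ → Series
geomInv j n = if does (j ∣? n) then + 1 else + 0

prodTo : ℕ → (ℕ → Series) → Series
prodTo zero    g = one
prodTo (suc N) g = prodTo N g ⊛ g (suc N)

-- f_k = ∏_{m ≥ 1} (1 - q^{k m}), for k ≥ 1.
-- The coefficient of q^n of the infinite product equals that of the
-- finite product over 1 ≤ m ≤ n (the remaining factors are ≡ 1 mod q^{n+1}).
f : ℕ → Series
f k n = prodTo n (λ m → oneMinus (k ℕ.* m)) n

-- 1/f_k = ∏_{m ≥ 1} 1/(1 - q^{k m}), for k ≥ 1, computed the same way.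
fInv : ℕ → Series
fInv k n = prodTo n (λ m → geomInv (k ℕ.* m)) n

-- Overpartition function: Σ p̄(n) q^n = f_2 / f_1^2.
pbar : ℕ → ℤ
pbar = f 2 ⊛ pow (fInv 1) 2

infixl 6 _⊕_
_⊕_ : Series → Series → Series
(a ⊕ b) n = a n + b n

{-# OPTIONS --safe #-}

-- Both sides vanish modulo 5.
--
-- Write a = φ(q) and b = φ(-q).  Gauss's identity b = f₁²/f₂ gives Σ p̄(n) qⁿ = 1/b ≡ b⁴/b(q⁵), so
-- Σ p̄(5n) qⁿ ≡ U₅(b⁴)/b, where U₅ extracts the exponents divisible by 5.  With X = a(a⁴ - b⁴), the Wronskian
-- formula 4(b θa - a θb) = ab(a⁴ - b⁴), θ = q d/dq, says b⁴ ≡ θX/X; since U₅ fixes logarithmic derivatives modulo 5,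
-- U₅(b⁴) ≡ b⁴ and Σ p̄(5n) qⁿ ≡ b³.  The coefficients of b³ are up to sign numbers of representations as sums of
-- three squares, so those at 8n + 7 are zero.
--
-- On the other side, put U = f₁¹⁶ f₄⁸ and T = q f₁⁸ f₄¹⁶.  Jacobi's identity a⁴ - b⁴ = 16 q f₄⁸/f₂⁴ becomes
-- f₂²⁴ ≡ U + T, which turns the eight quotients into f₂²/(f₁⁶³ f₄⁴⁰) times a quintic form in U and T that is
-- identically zero modulo 5.
--
-- The Wronskian formula and Jacobi's identity both follow from a² + b² = 2 a(q²)² and ab = b(q²)²: in each case the
-- difference d of the two sides satisfies an equation p(q) d(q) = v(q) d(q²) with p of order 1, which forces d = 0.
module Submission where

open import Defs
open import Data.Nat using (ℕ; zero; suc; z≤n; s≤s)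
open import Data.Integer using (ℤ; +_; -[1+_]; _+_; _-_; _*_; -_)
open import Data.Integer.Divisibility using (_∣_)
import Data.Nat as ℕ
import Data.Nat.Properties as ℕₚ
import Data.Nat.Divisibility as ℕ∣
import Data.Nat.Tactic.RingSolver as ℕ-Solver
import Data.Integer.Properties as ℤₚ
import Data.Integer.Divisibility.Signed as Signed
open import Data.Integer.DivMod using (_%ℕ_; _/ℕ_; a≡a%ℕn+[a/ℕn]*n)
open import Data.Integer.Tactic.RingSolver using (solve-∀)
open import Data.Bool using (if_then_else_)
open import Data.Maybe using (Maybe; just; nothing)
open import Data.Product using (_,_; _×_; Σ)
open import Data.Sum using (_⊎_; inj₁; inj₂)
open import Data.Unit using (⊤)
open import Function.Bundles using (mk⇔)
open import Relation.Nullary using (yes; no)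
open import Relation.Nullary.Decidable using (dec-true; dec-false; does-⇔)
open import Relation.Binary.PropositionalEquality using (_≡_; _≗_; refl; sym; trans; cong; cong₂; subst; module ≡-Reasoning)
open import Algebra.Bundles using (CommutativeRing; RawRing)
open import Algebra.Solver.Ring.AlmostCommutativeRing using (AlmostCommutativeRing; fromCommutativeRing; _-Raw-AlmostCommutative⟶_)
import Algebra.Solver.Ring as RingSolver
import Relation.Binary.Reasoning.Setoid as SetoidReasoning

-- The ring of formal power series

-- Uniqueness for `p(q) d(q) = v(q) d(q²)` is a comparison of orders. If `d` has order `N ≥ 2`, then
-- `p d` has order exactly `N + 1`, while `d(q²)` has order `2N > N + 1`. Hence two initial
-- coefficients decide each identity, and they can be computed. The Wronskian equation is linear
-- from the start. Jacobi's is not: both sides solve `x² = a(q²)⁴ x(q²)`, and subtracting the two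
-- equations leaves a linear one with `p` equal to the sum of the two solutions. Working modulo 5
-- makes 2 and 4 invertible, turns the 16 of Jacobi's identity into 1 and splits fifth powers. Only
-- the formula for `θ(a⁵)` has to be an equality of integers, because a factor 5 is cancelled in it.
-- Theta series are limits of sums and the `f n` limits of products. Gauss's identity is the one
-- bridge between them; it comes from a finite identity whose sum agrees with a finite product
-- modulo `q^(N+1)`. The quintic form vanishes because, with `Y = U + T`, `Y⁴ + Y³T + Y²T² + YT³ +
-- T⁴ ≡ (Y - T)⁴ = U⁴` modulo 5.

C : ℤ → Series
C z zero    = z
C z (suc _) = + 0

tail : Series → Series
tail a n = a (suc n)

cons : ℤ → Series → Series
cons z a zero    = z
cons z a (suc n) = a n

⊝_ : Series → Series
(⊝ a) n = - a n

sumTo-cong : ∀ n {g h : ℕ → ℤ} → (∀ i → i ℕ.≤ n → g i ≡ h i) → sumTo n g ≡ sumTo n h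
sumTo-cong zero    e = e 0 z≤n
sumTo-cong (suc n) e = cong₂ _+_ (sumTo-cong n λ i i≤n → e i (ℕₚ.m≤n⇒m≤1+n i≤n)) (e (suc n) ℕₚ.≤-refl)

sumTo-first : ∀ n g → sumTo (suc n) g ≡ g 0 + sumTo n (tail g)
sumTo-first zero    g = refl
sumTo-first (suc n) g = trans (cong (_+ g (suc (suc n))) (sumTo-first n g)) (ℤₚ.+-assoc (g 0) _ _)

-- Splitting off the head of the left factor turns a convolution into a recursion on tails. The ring
-- laws below follow from it by induction on the index, without reindexing double sums.
⊛-first : ∀ a b n → (a ⊛ b) (suc n) ≡ a 0 * b (suc n) + (tail a ⊛ b) n
⊛-first a b n = sumTo-first n (λ i → a i * b (suc n ℕ.∸ i))

⊛-last : ∀ a b n → (a ⊛ b) (suc n) ≡ (a ⊛ tail b) n + a (suc n) * b 0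
⊛-last a b n = cong₂ _+_
  (sumTo-cong n λ i i≤n → cong (λ k → a i * b k) (ℕₚ.+-∸-assoc 1 i≤n))
  (cong (λ k → a (suc n) * b k) (ℕₚ.n∸n≡0 n))

⊛-comm : ∀ a b → a ⊛ b ≗ b ⊛ a
⊛-comm a b zero    = ℤₚ.*-comm (a 0) (b 0)
⊛-comm a b (suc n) = begin
  (a ⊛ b) (suc n)                    ≡⟨ ⊛-first a b n ⟩
  a 0 * b (suc n) + (tail a ⊛ b) n   ≡⟨ cong₂ _+_ (ℤₚ.*-comm (a 0) _) (⊛-comm (tail a) b n) ⟩
  b (suc n) * a 0 + (b ⊛ tail a) n   ≡⟨ ℤₚ.+-comm (b (suc n) * a 0) _ ⟩
  (b ⊛ tail a) n + b (suc n) * a 0   ≡⟨ ⊛-last b a n ⟨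
  (b ⊛ a) (suc n)                    ∎
  where open ≡-Reasoning

⊛-distribʳ : ∀ c a b → (a ⊕ b) ⊛ c ≗ (a ⊛ c) ⊕ (b ⊛ c)
⊛-distribʳ c a b zero    = ℤₚ.*-distribʳ-+ (c 0) (a 0) (b 0)
⊛-distribʳ c a b (suc n) = begin
  ((a ⊕ b) ⊛ c) (suc n)
    ≡⟨ ⊛-first (a ⊕ b) c n ⟩
  (a 0 + b 0) * c (suc n) + ((tail a ⊕ tail b) ⊛ c) n
    ≡⟨ cong (_+_ ((a 0 + b 0) * c (suc n))) (⊛-distribʳ c (tail a) (tail b) n) ⟩
  (a 0 + b 0) * c (suc n) + ((tail a ⊛ c) n + (tail b ⊛ c) n)
    ≡⟨ lemma (a 0) (b 0) (c (suc n)) _ _ ⟩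
  (a 0 * c (suc n) + (tail a ⊛ c) n) + (b 0 * c (suc n) + (tail b ⊛ c) n)
    ≡⟨ cong₂ _+_ (⊛-first a c n) (⊛-first b c n) ⟨
  (a ⊛ c) (suc n) + (b ⊛ c) (suc n) ∎
  where
  open ≡-Reasoning
  lemma : ∀ x y z u v → (x + y) * z + (u + v) ≡ (x * z + u) + (y * z + v)
  lemma = solve-∀

scale-⊛ : ∀ z a b → scale z a ⊛ b ≗ scale z (a ⊛ b)
scale-⊛ z a b zero    = ℤₚ.*-assoc z (a 0) (b 0)
scale-⊛ z a b (suc n) = begin
  (scale z a ⊛ b) (suc n)                           ≡⟨ ⊛-first (scale z a) b n ⟩
  z * a 0 * b (suc n) + (scale z (tail a) ⊛ b) n    ≡⟨ cong₂ _+_ (ℤₚ.*-assoc z (a 0) _) (scale-⊛ z (tail a) b n) ⟩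
  z * (a 0 * b (suc n)) + z * (tail a ⊛ b) n        ≡⟨ ℤₚ.*-distribˡ-+ z _ _ ⟨
  z * (a 0 * b (suc n) + (tail a ⊛ b) n)            ≡⟨ cong (z *_) (⊛-first a b n) ⟨
  z * (a ⊛ b) (suc n)                               ∎
  where open ≡-Reasoning

⊛-cong-≗ : ∀ {a a' b b'} → a ≗ a' → b ≗ b' → a ⊛ b ≗ a' ⊛ b'
⊛-cong-≗ p r n = sumTo-cong n λ i _ → cong₂ _*_ (p i) (r (n ℕ.∸ i))

⊛-assoc : ∀ a b c → (a ⊛ b) ⊛ c ≗ a ⊛ (b ⊛ c)
⊛-assoc a b c zero    = ℤₚ.*-assoc (a 0) (b 0) (c 0)
⊛-assoc a b c (suc n) = begin
  ((a ⊛ b) ⊛ c) (suc n)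
    ≡⟨ ⊛-first (a ⊛ b) c n ⟩
  a 0 * b 0 * c (suc n) + (tail (a ⊛ b) ⊛ c) n
    ≡⟨ cong (_+_ (a 0 * b 0 * c (suc n))) (⊛-cong-≗ {b = c} (⊛-first a b) (λ _ → refl) n) ⟩
  a 0 * b 0 * c (suc n) + ((scale (a 0) (tail b) ⊕ (tail a ⊛ b)) ⊛ c) n
    ≡⟨ cong (_+_ (a 0 * b 0 * c (suc n))) (⊛-distribʳ c (scale (a 0) (tail b)) (tail a ⊛ b) n) ⟩
  a 0 * b 0 * c (suc n) + ((scale (a 0) (tail b) ⊛ c) n + ((tail a ⊛ b) ⊛ c) n)
    ≡⟨ cong₂ (λ u v → a 0 * b 0 * c (suc n) + (u + v)) (scale-⊛ (a 0) (tail b) c n) (⊛-assoc (tail a) b c n) ⟩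
  a 0 * b 0 * c (suc n) + (a 0 * (tail b ⊛ c) n + (tail a ⊛ (b ⊛ c)) n)
    ≡⟨ lemma (a 0) (b 0) (c (suc n)) _ _ ⟩
  a 0 * (b 0 * c (suc n) + (tail b ⊛ c) n) + (tail a ⊛ (b ⊛ c)) n
    ≡⟨ cong (λ u → a 0 * u + (tail a ⊛ (b ⊛ c)) n) (⊛-first b c n) ⟨
  a 0 * (b ⊛ c) (suc n) + (tail a ⊛ (b ⊛ c)) n
    ≡⟨ ⊛-first a (b ⊛ c) n ⟨
  (a ⊛ (b ⊛ c)) (suc n) ∎
  where
  open ≡-Reasoning
  lemma : ∀ x y z u v → x * y * z + (x * u + v) ≡ x * (y * z + u) + v
  lemma = solve-∀

C-⊛ : ∀ z a → C z ⊛ a ≗ scale z a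
C-⊛ z a zero    = refl
C-⊛ z a (suc n) = trans (⊛-first (C z) a n) (trans (cong (_+_ (z * a (suc n))) (null-⊛ n)) (ℤₚ.+-identityʳ _))
  where
  null-⊛ : ∀ n → ((λ _ → + 0) ⊛ a) n ≡ + 0
  null-⊛ zero    = refl
  null-⊛ (suc n) = trans (⊛-first (λ _ → + 0) a n) (trans (ℤₚ.+-identityˡ _) (null-⊛ n))

one≗C1 : one ≗ C (+ 1)
one≗C1 zero    = refl
one≗C1 (suc n) = refl

one-⊛ : ∀ a → one ⊛ a ≗ a
one-⊛ a n = trans (⊛-cong-≗ {b = a} one≗C1 (λ _ → refl) n) (trans (C-⊛ (+ 1) a n) (ℤₚ.*-identityˡ (a n)))

-- Congruences of integers and of power series

module IntMod (m : ℤ) where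

  infix 4 _~_
  record _~_ (x y : ℤ) : Set where
    constructor mod
    field divides-difference : m Signed.∣ x - y
  open _~_ public

  private
    pull : ∀ {x y z} → y ≡ z → m Signed.∣ y → (x ≡ z) → m Signed.∣ x
    pull refl d refl = d

  ~-reflexive : ∀ {x y} → x ≡ y → x ~ y
  ~-reflexive {x} refl = mod (Signed.divides (+ 0) (ℤₚ.+-inverseʳ x))

  ~-refl : ∀ {x} → x ~ x
  ~-refl = ~-reflexive refl

  ~-sym : ∀ {x y} → x ~ y → y ~ x
  ~-sym {x} {y} (mod d) = mod (pull refl (Signed.∣m⇒∣-m d) (lemma x y))
    where
    lemma : ∀ x y → y - x ≡ - (x - y)
    lemma = solve-∀

  ~-trans : ∀ {x y z} → x ~ y → y ~ z → x ~ z
  ~-trans {x} {y} {z} (mod d) (mod e) = mod (pull refl (Signed.∣m∣n⇒∣m+n d e) (lemma x y z))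
    where
    lemma : ∀ x y z → x - z ≡ (x - y) + (y - z)
    lemma = solve-∀

  ~-+ : ∀ {x y u v} → x ~ y → u ~ v → x + u ~ y + v
  ~-+ {x} {y} {u} {v} (mod d) (mod e) = mod (pull refl (Signed.∣m∣n⇒∣m+n d e) (lemma x y u v))
    where
    lemma : ∀ x y u v → (x + u) - (y + v) ≡ (x - y) + (u - v)
    lemma = solve-∀

  ~-neg : ∀ {x y} → x ~ y → - x ~ - y
  ~-neg {x} {y} (mod d) = mod (pull refl (Signed.∣m⇒∣-m d) (lemma x y))
    where
    lemma : ∀ x y → - x - - y ≡ - (x - y)
    lemma = solve-∀

  ~-* : ∀ {x y u v} → x ~ y → u ~ v → x * u ~ y * v
  ~-* {x} {y} {u} {v} (mod d) (mod e) =
    mod (pull refl (Signed.∣m∣n⇒∣m+n (Signed.∣m⇒∣m*n u d) (Signed.∣n⇒∣m*n y e)) (lemma x y u v))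
    where
    lemma : ∀ x y u v → x * u - y * v ≡ (x - y) * u + y * (u - v)
    lemma = solve-∀

  ~-sumTo : ∀ n {g h : ℕ → ℤ} → (∀ i → i ℕ.≤ n → g i ~ h i) → sumTo n g ~ sumTo n h
  ~-sumTo zero    e = e 0 z≤n
  ~-sumTo (suc n) e = ~-+ (~-sumTo n λ i i≤n → e i (ℕₚ.m≤n⇒m≤1+n i≤n)) (e (suc n) ℕₚ.≤-refl)

-- Congruence modulo m of the coefficients whose index satisfies P.
module SeriesMod (m : ℕ) (P : ℕ → Set) (↓ : ∀ {i n} → i ℕ.≤ n → P n → P i) where
  open IntMod (+ m) public

  infix 4 _≈_
  record _≈_ (a b : Series) : Set where
    constructor at
    field coeff : ∀ n → P n → a n ~ b n
  open _≈_ public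

  exactly : ∀ {a b} → a ≗ b → a ≈ b
  exactly e = at λ n _ → ~-reflexive (e n)

  ≈-refl : ∀ {a} → a ≈ a
  ≈-refl = at λ _ _ → ~-refl

  ≈-sym : ∀ {a b} → a ≈ b → b ≈ a
  ≈-sym e = at λ n p → ~-sym (coeff e n p)

  ≈-trans : ∀ {a b c} → a ≈ b → b ≈ c → a ≈ c
  ≈-trans d e = at λ n p → ~-trans (coeff d n p) (coeff e n p)

  ⊕-cong : ∀ {a b c d} → a ≈ b → c ≈ d → a ⊕ c ≈ b ⊕ d
  ⊕-cong d e = at λ n p → ~-+ (coeff d n p) (coeff e n p)

  ⊝-cong : ∀ {a b} → a ≈ b → ⊝ a ≈ ⊝ b
  ⊝-cong d = at λ n p → ~-neg (coeff d n p)

  ⊛-cong : ∀ {a b c d} → a ≈ b → c ≈ d → a ⊛ c ≈ b ⊛ d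
  ⊛-cong d e = at λ n p → ~-sumTo n λ i i≤n →
    ~-* (coeff d i (↓ i≤n p)) (coeff e (n ℕ.∸ i) (↓ (ℕₚ.m∸n≤m n i) p))

  ⊕ˡ : ∀ a {b c} → b ≈ c → a ⊕ b ≈ a ⊕ c
  ⊕ˡ a e = ⊕-cong (≈-refl {a}) e

  ⊕ʳ : ∀ {a b} → a ≈ b → ∀ c → a ⊕ c ≈ b ⊕ c
  ⊕ʳ e c = ⊕-cong e (≈-refl {c})

  ⊛ˡ : ∀ a {b c} → b ≈ c → a ⊛ b ≈ a ⊛ c
  ⊛ˡ a e = ⊛-cong (≈-refl {a}) e

  ⊛ʳ : ∀ {a b} → a ≈ b → ∀ c → a ⊛ c ≈ b ⊛ c
  ⊛ʳ e c = ⊛-cong e (≈-refl {c})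

  pow-cong : ∀ n {a b} → a ≈ b → pow a n ≈ pow b n
  pow-cong zero    e = ≈-refl
  pow-cong (suc n) e = ⊛-cong e (pow-cong n e)

  ring : CommutativeRing _ _
  ring = record
    { Carrier = Series ; _≈_ = _≈_ ; _+_ = _⊕_ ; _*_ = _⊛_ ; -_ = ⊝_ ; 0# = C (+ 0) ; 1# = one
    ; isCommutativeRing = record
      { isRing = record
        { +-isAbelianGroup = record
          { isGroup = record
            { isMonoid = record
              { isSemigroup = record
                { isMagma = record
                  { isEquivalence = record { refl = ≈-refl ; sym = ≈-sym ; trans = ≈-trans }
                  ; ∙-cong = ⊕-cong }
                ; assoc = λ a b c → exactly λ n → ℤₚ.+-assoc (a n) (b n) (c n) }
              ; identity = (λ a → exactly λ { zero → ℤₚ.+-identityˡ (a 0) ; (suc n) → ℤₚ.+-identityˡ (a (suc n)) })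
                         , (λ a → exactly λ { zero → ℤₚ.+-identityʳ (a 0) ; (suc n) → ℤₚ.+-identityʳ (a (suc n)) }) }
            ; inverse = (λ a → exactly λ { zero → ℤₚ.+-inverseˡ (a 0) ; (suc n) → ℤₚ.+-inverseˡ (a (suc n)) })
                      , (λ a → exactly λ { zero → ℤₚ.+-inverseʳ (a 0) ; (suc n) → ℤₚ.+-inverseʳ (a (suc n)) })
            ; ⁻¹-cong = ⊝-cong }
          ; comm = λ a b → exactly λ n → ℤₚ.+-comm (a n) (b n) }
        ; *-cong = ⊛-cong
        ; *-assoc = λ a b c → exactly (⊛-assoc a b c)
        ; *-identity = (λ a → exactly (one-⊛ a))
                     , (λ a → exactly λ n → trans (⊛-comm a one n) (one-⊛ a n))
        ; distrib = (λ c a b → exactly λ n → trans (⊛-comm c (a ⊕ b) n)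
                       (trans (⊛-distribʳ c a b n) (cong₂ _+_ (⊛-comm a c n) (⊛-comm b c n))))
                  , (λ c a b → exactly (⊛-distribʳ c a b)) }
      ; *-comm = λ a b → exactly (⊛-comm a b) } }

  module Ring = CommutativeRing ring

  almostRing : AlmostCommutativeRing _ _
  almostRing = fromCommutativeRing ring

  C-cong : ∀ {x y} → x ~ y → C x ≈ C y
  C-cong e = at λ { zero _ → e ; (suc n) _ → ~-refl }

  private
    -- The solver compares coefficients syntactically, so they are kept reduced modulo m.
    residue : ℕ → ℤ → ℤ
    residue zero    x = x
    residue (suc k) x = + (x %ℕ suc k)

    residue-~ : ∀ m x → IntMod._~_ (+ m) (residue m x) x
    residue-~ zero    x = IntMod.~-refl (+ 0)
    residue-~ (suc k) x = IntMod.mod (Signed.divides (- (x /ℕ suc k))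
      (trans (cong (_-_ (+ (x %ℕ suc k))) (a≡a%ℕn+[a/ℕn]*n x (suc k))) (lemma (+ (x %ℕ suc k)) (x /ℕ suc k) (+ suc k))))
      where
      lemma : ∀ r d k → r - (r + d * k) ≡ - d * k
      lemma = solve-∀

    C-residue : ∀ x → C (residue m x) ≈ C x
    C-residue x = C-cong (residue-~ m x)

    residues : RawRing _ _
    residues = record
      { Carrier = ℤ ; _≈_ = _≡_ ; _+_ = λ x y → residue m (x + y) ; _*_ = λ x y → residue m (x * y)
      ; -_ = λ x → residue m (- x) ; 0# = + 0 ; 1# = + 1 }

    constants : residues -Raw-AlmostCommutative⟶ almostRing
    constants = record
      { ⟦_⟧    = C
      ; +-homo = λ x y → ≈-trans (C-residue (x + y)) (exactly λ { zero → refl ; (suc n) → refl })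
      ; *-homo = λ x y → ≈-trans (C-residue (x * y))
          (exactly λ { zero → refl ; (suc n) → sym (trans (C-⊛ x (C y) (suc n)) (ℤₚ.*-zeroʳ x)) })
      ; -‿homo = λ x → ≈-trans (C-residue (- x)) (exactly λ { zero → refl ; (suc n) → refl })
      ; 0-homo = ≈-refl
      ; 1-homo = exactly λ n → sym (one≗C1 n) }

    equalConstants? : ∀ x y → Maybe (C x ≈ C y)
    equalConstants? x y with + m Signed.∣? (x - y)
    ... | yes d = just (C-cong (mod d))
    ... | no  _ = nothing

  module Solver = RingSolver residues almostRing constants equalConstants?
  module ≈-Reasoning = SetoidReasoning Ring.setoid

module Mod₅ = SeriesMod 5 (λ _ → ⊤) (λ _ _ → _)
-- Equality modulo 5 and modulo `q^N`: the level at which an infinite product or theta series may be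
-- replaced by a finite one.
module Mod₅< (N : ℕ) = SeriesMod 5 (ℕ._< N) (ℕₚ.≤-<-trans)

open Mod₅
open Solver

-- Substitutions q ↦ q t

q : Series
q = mono 1

q-⊛ : ∀ a → q ⊛ a ≗ cons (+ 0) a
q-⊛ a zero    = refl
q-⊛ a (suc n) = begin
  (q ⊛ a) (suc n)                        ≡⟨ ⊛-first q a n ⟩
  + 0 * a (suc n) + (tail q ⊛ a) n       ≡⟨ ℤₚ.+-identityˡ ((tail q ⊛ a) n) ⟩
  (tail q ⊛ a) n                         ≡⟨ ⊛-cong-≗ {tail q} {one} {a} (λ { zero → refl ; (suc _) → refl }) (λ _ → refl) n ⟩
  (one ⊛ a) n                            ≡⟨ one-⊛ a n ⟩
  a n                                    ∎
  where open ≡-Reasoning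

q-⊛-zero : ∀ a → (q ⊛ a) 0 ≡ + 0
q-⊛-zero a = q-⊛ a 0

q-⊛-suc : ∀ a n → (q ⊛ a) (suc n) ≡ a n
q-⊛-suc a n = q-⊛ a (suc n)

head-tail : ∀ a → a ≈ C (a 0) ⊕ q ⊛ tail a
head-tail a = exactly λ
  { zero    → sym (trans (cong (_+_ (a 0)) (q-⊛-zero (tail a))) (ℤₚ.+-identityʳ (a 0)))
  ; (suc n) → sym (trans (ℤₚ.+-identityˡ _) (q-⊛-suc (tail a) n)) }

-- Truncation modulo powers of q, and coinduction

module _ (N : ℕ) where
  private module M = Mod₅< N

  truncate : ∀ {a b} → a ≈ b → a M.≈ b
  truncate e = M.at λ n _ → coeff e n _

q-⊛-cong< : ∀ {N a b} → Mod₅<._≈_ N a b → Mod₅<._≈_ (suc N) (q ⊛ a) (q ⊛ b)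
q-⊛-cong< {N} {a} {b} e = Mod₅<.at λ
  { zero    _           → ~-reflexive (trans (q-⊛-zero a) (sym (q-⊛-zero b)))
  ; (suc n) (s≤s n<N) → ~-trans (~-reflexive (q-⊛-suc a n))
      (~-trans (Mod₅<.coeff e n n<N) (~-reflexive (sym (q-⊛-suc b n)))) }

untruncate : ∀ {a b} → (∀ N → Mod₅<._≈_ N a b) → a ≈ b
untruncate e = at λ n _ → Mod₅<.coeff (e (suc n)) n ℕₚ.≤-refl

-- The factor `q` guards the recursion: agreement modulo `q^N` at every index gives agreement modulo
-- `q^(N+1)` at every index. The index type holds the arguments of an operator, so that `next` can
-- pass to their tails.
coinduction : {I : Set} (x y r z : I → Series) (next : I → I) →
  (∀ i → x i ≈ r i ⊕ q ⊛ (z i ⊛ x (next i))) →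
  (∀ i → y i ≈ r i ⊕ q ⊛ (z i ⊛ y (next i))) →
  ∀ i → x i ≈ y i
coinduction x y r z next ex ey i = untruncate λ N → go N i
  where
  go : ∀ N i → Mod₅<._≈_ N (x i) (y i)
  go zero    i = Mod₅<.at λ _ ()
  go (suc N) i = ≈-trans′ (truncate (suc N) (ex i))
    (≈-trans′ (⊕ˡ′ (r i) (q-⊛-cong< (Mod₅<.⊛ˡ N (z i) (go N (next i)))))
      (≈-sym′ (truncate (suc N) (ey i))))
    where
    open Mod₅< (suc N) using () renaming (≈-trans to ≈-trans′; ⊕ˡ to ⊕ˡ′; ≈-sym to ≈-sym′)

one≈C1 : one ≈ C (+ 1)
one≈C1 = exactly one≗C1

scale≈ : ∀ z a → scale z a ≈ C z ⊛ a
scale≈ z a = exactly λ n → sym (C-⊛ z a n)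

≈-head : ∀ {a b} → a ≈ b → a 0 ~ b 0
≈-head e = coeff e 0 _

≈-tail : ∀ {a b} → a ≈ b → tail a ≈ tail b
≈-tail e = at λ n _ → coeff e (suc n) _

-- S is the substitution q ↦ q t.
module Substitution (S : Series → Series) (t : Series)
  (unfold : ∀ a → S a ≈ C (a 0) ⊕ q ⊛ (t ⊛ S (tail a))) where

  -- `S` acts on representatives and is not assumed to respect congruence. The congruence proof
  -- therefore travels in the index and is passed on to the tails.
  S-cong : ∀ {a b} → a ≈ b → S a ≈ S b
  S-cong {a} {b} e = coinduction {Σ Series λ a → Σ Series λ b → a ≈ b}
    (λ (a , b , e) → S a) (λ (a , b , e) → S b) (λ (a , b , e) → C (a 0)) (λ _ → t)
    (λ (a , b , e) → tail a , tail b , ≈-tail e)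
    (λ (a , b , e) → unfold a)
    (λ (a , b , e) → ≈-trans (unfold b) (⊕ʳ (C-cong (~-sym (≈-head e))) _))
    (a , b , e)

  S-⊕ : ∀ a b → S (a ⊕ b) ≈ S a ⊕ S b
  S-⊕ a b = coinduction {Series × Series}
    (λ (a , b) → S (a ⊕ b)) (λ (a , b) → S a ⊕ S b) (λ (a , b) → C (a 0 + b 0)) (λ _ → t)
    (λ (a , b) → tail a , tail b)
    (λ (a , b) → unfold (a ⊕ b))
    (λ (a , b) → ≈-trans (⊕-cong (unfold a) (unfold b))
      (≈-trans (solve 6 (λ x u q t y v → (x :+ q :* (t :* u)) :+ (y :+ q :* (t :* v)) := (x :+ y) :+ q :* (t :* (u :+ v)))
         ≈-refl (C (a 0)) (S (tail a)) q t (C (b 0)) (S (tail b)))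
      (⊕ʳ {C (a 0) ⊕ C (b 0)} {C (a 0 + b 0)} (exactly λ { zero → refl ; (suc n) → refl }) _)))
    (a , b)

  S-scale : ∀ z a → S (scale z a) ≈ C z ⊛ S a
  S-scale z = coinduction (λ a → S (scale z a)) (λ a → C z ⊛ S a) (λ a → C (z * a 0)) (λ _ → t) tail
    (λ a → unfold (scale z a))
    (λ a → ≈-trans (⊛ˡ (C z) (unfold a))
      (≈-trans (solve 5 (λ z x u q t → z :* (x :+ q :* (t :* u)) := z :* x :+ q :* (t :* (z :* u)))
         ≈-refl (C z) (C (a 0)) (S (tail a)) q t)
      (⊕ʳ {C z ⊛ C (a 0)} {C (z * a 0)} (exactly λ { zero → refl ; (suc n) → trans (C-⊛ z (C (a 0)) (suc n)) (ℤₚ.*-zeroʳ z) }) _)))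

  S-C⊛ : ∀ z a → S (C z ⊛ a) ≈ C z ⊛ S a
  S-C⊛ z a = ≈-trans (S-cong (≈-sym (scale≈ z a))) (S-scale z a)

  S-zero : S (C (+ 0)) ≈ C (+ 0)
  S-zero = ≈-trans (S-cong {C (+ 0)} {C (+ 0) ⊛ C (+ 1)} (solve 0 (con (+ 0) := con (+ 0) :* con (+ 1)) ≈-refl))
    (≈-trans (S-C⊛ (+ 0) (C (+ 1))) (solve 1 (λ x → con (+ 0) :* x := con (+ 0)) ≈-refl (S (C (+ 1)))))

  S-C : ∀ z → S (C z) ≈ C z
  S-C z = ≈-trans (unfold (C z)) (≈-trans (⊕ˡ (C z) (⊛ˡ q (⊛ˡ t
      (≈-trans (S-cong {tail (C z)} {C (+ 0)} (exactly λ { zero → refl ; (suc n) → refl })) S-zero))))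
    (solve 3 (λ z q t → z :+ q :* (t :* con (+ 0)) := z) ≈-refl (C z) q t))

  S-one : S one ≈ one
  S-one = ≈-trans (S-cong one≈C1) (≈-trans (S-C (+ 1)) (≈-sym one≈C1))

  S-q⊛ : ∀ a → S (q ⊛ a) ≈ q ⊛ (t ⊛ S a)
  S-q⊛ a = ≈-trans (unfold (q ⊛ a))
    (≈-trans (⊕-cong (C-cong (~-reflexive (q-⊛-zero a))) (⊛ˡ q (⊛ˡ t (S-cong {tail (q ⊛ a)} {a} (exactly (q-⊛-suc a))))))
    (solve 1 (λ x → con (+ 0) :+ x := x) ≈-refl (q ⊛ (t ⊛ S a))))

  S-q : S q ≈ q ⊛ t
  S-q = ≈-trans (S-cong {q} {q ⊛ C (+ 1)} (solve 1 (λ q → q := q :* con (+ 1)) ≈-refl q))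
    (≈-trans (S-q⊛ (C (+ 1))) (≈-trans (⊛ˡ q (⊛ˡ t (S-C (+ 1))))
      (solve 2 (λ q t → q :* (t :* con (+ 1)) := q :* t) ≈-refl q t)))

  S-⊛ : ∀ a b → S (a ⊛ b) ≈ S a ⊛ S b
  S-⊛ a b = coinduction (λ a → S (a ⊛ b)) (λ a → S a ⊛ S b) (λ a → C (a 0) ⊛ S b) (λ _ → t) tail
    (λ a → begin
      S (a ⊛ b)
        ≈⟨ S-cong (⊛ʳ (head-tail a) b) ⟩
      S ((C (a 0) ⊕ q ⊛ tail a) ⊛ b)
        ≈⟨ S-cong {(C (a 0) ⊕ q ⊛ tail a) ⊛ b} {C (a 0) ⊛ b ⊕ q ⊛ (tail a ⊛ b)} (solve 4 (λ x q y b → (x :+ q :* y) :* b := x :* b :+ q :* (y :* b)) ≈-refl (C (a 0)) q (tail a) b) ⟩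
      S (C (a 0) ⊛ b ⊕ q ⊛ (tail a ⊛ b))
        ≈⟨ S-⊕ (C (a 0) ⊛ b) (q ⊛ (tail a ⊛ b)) ⟩
      S (C (a 0) ⊛ b) ⊕ S (q ⊛ (tail a ⊛ b))
        ≈⟨ ⊕-cong (S-C⊛ (a 0) b) (S-q⊛ (tail a ⊛ b)) ⟩
      C (a 0) ⊛ S b ⊕ q ⊛ (t ⊛ S (tail a ⊛ b)) ∎)
    (λ a → ≈-trans (⊛ʳ (unfold a) (S b))
      (solve 5 (λ x q t y b → (x :+ q :* (t :* y)) :* b := x :* b :+ q :* (t :* (y :* b))) ≈-refl (C (a 0)) q t (S (tail a)) (S b)))
    a
    where open ≈-Reasoning

  S-⊝ : ∀ a → S (⊝ a) ≈ ⊝ S a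
  S-⊝ a = ≈-trans (S-cong {⊝ a} {C (- + 1) ⊛ a} (solve 1 (λ a → :- a := con (- + 1) :* a) ≈-refl a))
    (≈-trans (S-C⊛ (- + 1) a) (solve 1 (λ a → con (- + 1) :* a := :- a) ≈-refl (S a)))

  S-pow : ∀ a n → S (pow a n) ≈ pow (S a) n
  S-pow a zero    = S-one
  S-pow a (suc n) = ≈-trans (S-⊛ a (pow a n)) (⊛ˡ (S a) (S-pow a n))

  -- Since `q t` has no constant term, the substitution does not lower orders. This continuity
  -- allows `S` to be applied to a limit through its finite stages.
  S-cong< : ∀ N {a b} → Mod₅<._≈_ N a b → Mod₅<._≈_ N (S a) (S b)
  S-cong< zero    e = Mod₅<.at λ _ ()
  S-cong< (suc N) {a} {b} e = M.≈-trans (truncate (suc N) (unfold a)) (M.≈-trans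
    (M.⊕-cong {C (a 0)} {C (b 0)} (M.at λ { zero _ → M.coeff e 0 (s≤s z≤n) ; (suc n) _ → ~-refl })
      (q-⊛-cong< (Mod₅<.⊛ˡ N t (S-cong< N {tail a} {tail b} (Mod₅<.at λ n n<N → M.coeff e (suc n) (s≤s n<N))))))
    (M.≈-sym (truncate (suc N) (unfold b))))
    where module M = Mod₅< (suc N)

-- q^j a(q^(k+1))
dilate : ℕ → ℕ → Series → Series
dilate k zero    a zero    = a 0
dilate k zero    a (suc n) = dilate k k (tail a) n
dilate k (suc j) a zero    = + 0
dilate k (suc j) a (suc n) = dilate k j a n

dilate-pow : ∀ k j a → dilate k j a ≈ pow q j ⊛ dilate k 0 a
dilate-pow k zero    a = ≈-sym (Ring.*-identityˡ _)
dilate-pow k (suc j) a = ≈-trans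
  (exactly {dilate k (suc j) a} {q ⊛ dilate k j a} λ { zero → sym (q-⊛-zero (dilate k j a)) ; (suc n) → sym (q-⊛-suc (dilate k j a) n) })
  (≈-trans (⊛ˡ q (dilate-pow k j a)) (≈-sym (Ring.*-assoc q (pow q j) (dilate k 0 a))))

dilate-unfold : ∀ k a → dilate k 0 a ≈ C (a 0) ⊕ q ⊛ (pow q k ⊛ dilate k 0 (tail a))
dilate-unfold k a = ≈-trans (head-tail (dilate k 0 a)) (⊕ˡ (C (a 0)) (⊛ˡ q (dilate-pow k k (tail a))))

σ₂ σ₅ : Series → Series
σ₂ = dilate 1 0
σ₅ = dilate 4 0

-- The substitution `q ↦ -q`.
ν : Series → Series
ν a zero    = a 0
ν a (suc n) = - ν (tail a) n

ν-unfold : ∀ a → ν a ≈ C (a 0) ⊕ q ⊛ (C (- + 1) ⊛ ν (tail a))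
ν-unfold a = ≈-trans (head-tail (ν a)) (⊕ˡ (C (a 0)) (⊛ˡ q
  (solve 1 (λ x → :- x := con (- + 1) :* x) ≈-refl (ν (tail a)))))

module Sub₂ = Substitution σ₂ (pow q 1) (dilate-unfold 1)
module Subν = Substitution ν (C (- + 1)) ν-unfold

ν-σ₂ : ∀ a → ν (σ₂ a) ≈ σ₂ a
ν-σ₂ = coinduction (λ a → ν (σ₂ a)) σ₂ (λ a → C (a 0)) (λ _ → pow q 1) tail
  (λ a → begin
    ν (σ₂ a)
      ≈⟨ Subν.S-cong (dilate-unfold 1 a) ⟩
    ν (C (a 0) ⊕ q ⊛ (pow q 1 ⊛ σ₂ (tail a)))
      ≈⟨ Subν.S-cong {C (a 0) ⊕ q ⊛ (pow q 1 ⊛ σ₂ (tail a))} {C (a 0) ⊕ q ⊛ (q ⊛ σ₂ (tail a))} (solve 3 (λ x q y → x :+ q :* (q :^ 1 :* y) := x :+ q :* (q :* y)) ≈-refl (C (a 0)) q (σ₂ (tail a))) ⟩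
    ν (C (a 0) ⊕ q ⊛ (q ⊛ σ₂ (tail a)))
      ≈⟨ Subν.S-⊕ (C (a 0)) (q ⊛ (q ⊛ σ₂ (tail a))) ⟩
    ν (C (a 0)) ⊕ ν (q ⊛ (q ⊛ σ₂ (tail a)))
      ≈⟨ ⊕-cong (Subν.S-C (a 0)) (≈-trans (Subν.S-q⊛ (q ⊛ σ₂ (tail a))) (⊛ˡ q (⊛ˡ (C (- + 1)) (Subν.S-q⊛ (σ₂ (tail a)))))) ⟩
    C (a 0) ⊕ q ⊛ (C (- + 1) ⊛ (q ⊛ (C (- + 1) ⊛ ν (σ₂ (tail a)))))
      ≈⟨ solve 3 (λ x q y → x :+ q :* (con (- + 1) :* (q :* (con (- + 1) :* y))) := x :+ q :* (q :^ 1 :* y)) ≈-refl (C (a 0)) q (ν (σ₂ (tail a))) ⟩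
    C (a 0) ⊕ q ⊛ (pow q 1 ⊛ ν (σ₂ (tail a))) ∎)
  (dilate-unfold 1)
  where open ≈-Reasoning

-- The inner binomial coefficients of a fifth power are divisible by 5, so `(x + q y)⁵` splits into
-- `x⁵ + q⁵ y⁵`. Fermat's little theorem handles the constant `x`, and the tail `y` is left to
-- coinduction.
frobenius : ∀ a → pow a 5 ≈ σ₅ a
frobenius = coinduction (λ a → pow a 5) σ₅ (λ a → C (a 0)) (λ _ → pow q 4) tail
  (λ a → begin
    pow a 5
      ≈⟨ pow-cong 5 (head-tail a) ⟩
    pow (C (a 0) ⊕ q ⊛ tail a) 5
      ≈⟨ solve 3 (λ x q y → (x :+ q :* y) :^ 5 := x :^ 5 :+ q :* (q :^ 4 :* y :^ 5)) ≈-refl (C (a 0)) q (tail a) ⟩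
    pow (C (a 0)) 5 ⊕ q ⊛ (pow q 4 ⊛ pow (tail a) 5)
      ≈⟨ ⊕ʳ (fermat (a 0)) (q ⊛ (pow q 4 ⊛ pow (tail a) 5)) ⟩
    C (a 0) ⊕ q ⊛ (pow q 4 ⊛ pow (tail a) 5) ∎)
  (dilate-unfold 4)
  where
  open ≈-Reasoning
  -- Fermat's theorem by induction on the integer: the fifth power is additive modulo 5.
  succ : ∀ x → pow (C x) 5 ≈ C x → pow (C x ⊕ C (+ 1)) 5 ≈ C x ⊕ C (+ 1)
  succ x e = ≈-trans (solve 2 (λ x y → (x :+ y) :^ 5 := x :^ 5 :+ y :^ 5) ≈-refl (C x) (C (+ 1)))
    (⊕-cong e (solve 0 (con (+ 1) :^ 5 := con (+ 1)) ≈-refl))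
  C-⊕ : ∀ x y → C (x + y) ≈ C x ⊕ C y
  C-⊕ x y = exactly λ { zero → refl ; (suc n) → refl }
  C-⊝ : ∀ x → C (- x) ≈ ⊝ C x
  C-⊝ x = exactly λ { zero → refl ; (suc n) → refl }
  fermatℕ : ∀ n → pow (C (+ n)) 5 ≈ C (+ n)
  fermatℕ zero    = solve 0 (con (+ 0) :^ 5 := con (+ 0)) ≈-refl
  fermatℕ (suc n) = ≈-trans (pow-cong 5 e) (≈-trans (succ (+ n) (fermatℕ n)) (≈-sym e))
    where
    e : C (+ suc n) ≈ C (+ n) ⊕ C (+ 1)
    e = ≈-trans (C-cong (~-reflexive (ℤₚ.+-comm (+ 1) (+ n)))) (C-⊕ (+ n) (+ 1))
  fermat : ∀ x → pow (C x) 5 ≈ C x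
  fermat (+ n)    = fermatℕ n
  fermat -[1+ n ] = ≈-trans (pow-cong 5 (C-⊝ (+ suc n)))
    (≈-trans (solve 1 (λ x → (:- x) :^ 5 := :- x :^ 5) ≈-refl (C (+ suc n)))
    (≈-trans (⊝-cong (fermatℕ (suc n))) (≈-sym (C-⊝ (+ suc n)))))

-- The derivation q d/dq and the operator U₅

θ : Series → Series
θ a n = + n * a n

sumTo-⊕ : ∀ n g h → sumTo n (g ⊕ h) ≡ sumTo n g + sumTo n h
sumTo-⊕ zero    g h = refl
sumTo-⊕ (suc n) g h = trans (cong (_+ (g ⊕ h) (suc n)) (sumTo-⊕ n g h)) (lemma (sumTo n g) (sumTo n h) _ _)
  where
  lemma : ∀ x y u v → (x + y) + (u + v) ≡ (x + u) + (y + v)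
  lemma = solve-∀

*-sumTo : ∀ z n g → z * sumTo n g ≡ sumTo n (λ i → z * g i)
*-sumTo z zero    g = refl
*-sumTo z (suc n) g = trans (ℤₚ.*-distribˡ-+ z (sumTo n g) _) (cong (_+ z * g (suc n)) (*-sumTo z n g))

leibniz : ∀ a b → θ (a ⊛ b) ≗ (θ a ⊛ b) ⊕ (a ⊛ θ b)
leibniz a b n = begin
  + n * sumTo n (λ i → a i * b (n ℕ.∸ i))
    ≡⟨ *-sumTo (+ n) n _ ⟩
  sumTo n (λ i → + n * (a i * b (n ℕ.∸ i)))
    ≡⟨ sumTo-cong n (λ i i≤n → trans
         (cong (_* (a i * b (n ℕ.∸ i))) (cong +_ (sym (ℕₚ.m+[n∸m]≡n i≤n))))
         (lemma (+ i) (+ (n ℕ.∸ i)) (a i) (b (n ℕ.∸ i)))) ⟩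
  sumTo n (λ i → θ a i * b (n ℕ.∸ i) + a i * θ b (n ℕ.∸ i))
    ≡⟨ sumTo-⊕ n (λ i → θ a i * b (n ℕ.∸ i)) (λ i → a i * θ b (n ℕ.∸ i)) ⟩
  (θ a ⊛ b) n + (a ⊛ θ b) n ∎
  where
  open ≡-Reasoning
  lemma : ∀ i j x y → (i + j) * (x * y) ≡ i * x * y + x * (j * y)
  lemma = solve-∀

θ-⊛ : ∀ a b → θ (a ⊛ b) ≈ θ a ⊛ b ⊕ a ⊛ θ b
θ-⊛ a b = exactly (leibniz a b)

θ-cong : ∀ {a b} → a ≈ b → θ a ≈ θ b
θ-cong e = at λ n _ → ~-* (~-refl {+ n}) (coeff e n _)

θ-⊕ : ∀ a b → θ (a ⊕ b) ≈ θ a ⊕ θ b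
θ-⊕ a b = exactly λ n → ℤₚ.*-distribˡ-+ (+ n) (a n) (b n)

θ-⊝ : ∀ a → θ (⊝ a) ≈ ⊝ θ a
θ-⊝ a = exactly λ n → sym (ℤₚ.neg-distribʳ-* (+ n) (a n))

θ-one : θ one ≗ C (+ 0)
θ-one zero    = refl
θ-one (suc n) = ℤₚ.*-zeroʳ (+ suc n)

θ-scale : ∀ z a → θ (scale z a) ≗ scale z (θ a)
θ-scale z a n = lemma (+ n) z (a n)
  where
  lemma : ∀ x y z → x * (y * z) ≡ y * (x * z)
  lemma = solve-∀

-- The offset `c` makes the induction possible: each step of `σ₂` drops two indices, and the offset
-- absorbs them. The case `c = 0` is the chain rule `θ-σ₂`.
σ₂-index : ∀ c a n → (+ c + + n) * σ₂ a n ≡ σ₂ (λ i → (+ c + + 2 * + i) * a i) n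
σ₂-index c a zero          = cong (λ u → (+ c + u) * a 0) (sym (ℤₚ.*-zeroʳ (+ 2)))
σ₂-index c a (suc zero)    = ℤₚ.*-zeroʳ (+ c + + 1)
σ₂-index c a (suc (suc n)) = begin
  (+ c + + suc (suc n)) * σ₂ (tail a) n
    ≡⟨ cong (λ k → + k * σ₂ (tail a) n) (trans (ℕₚ.+-suc c (suc n)) (cong suc (ℕₚ.+-suc c n))) ⟩
  (+ suc (suc c) + + n) * σ₂ (tail a) n
    ≡⟨ σ₂-index (suc (suc c)) (tail a) n ⟩
  σ₂ (λ i → (+ suc (suc c) + + 2 * + i) * a (suc i)) n
    ≡⟨ σ₂-≗ (λ i → cong (_* a (suc i)) (lemma (+ c) (+ i))) n ⟩
  σ₂ (λ i → (+ c + + 2 * + suc i) * a (suc i)) n ∎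
  where
  open ≡-Reasoning
  lemma : ∀ x y → (+ 2 + x) + + 2 * y ≡ x + + 2 * (+ 1 + y)
  lemma = solve-∀
  σ₂-≗ : ∀ {x y : Series} → x ≗ y → σ₂ x ≗ σ₂ y
  σ₂-≗ e zero          = e 0
  σ₂-≗ e (suc zero)    = refl
  σ₂-≗ e (suc (suc n)) = σ₂-≗ (λ i → e (suc i)) n

θ-σ₂ : ∀ a → θ (σ₂ a) ≈ C (+ 2) ⊛ σ₂ (θ a)
θ-σ₂ a = ≈-trans
  (exactly λ n → trans (cong (_* σ₂ a n) (sym (ℤₚ.+-identityˡ (+ n)))) (σ₂-index 0 a n))
  (≈-trans (Sub₂.S-cong {λ i → (+ 0 + + 2 * + i) * a i} {scale (+ 2) (θ a)} (exactly λ i →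
      trans (cong (_* a i) (ℤₚ.+-identityˡ (+ 2 * + i))) (ℤₚ.*-assoc (+ 2) (+ i) (a i))))
    (Sub₂.S-scale (+ 2) (θ a)))

U₅ : Series → Series
U₅ a n = a (n ℕ.* 5)

U₅-cong : ∀ {a b} → a ≈ b → U₅ a ≈ U₅ b
U₅-cong e = at λ n _ → coeff e (n ℕ.* 5) _

U₅-σ₅ : ∀ a → U₅ (σ₅ a) ≗ a
U₅-σ₅ a zero    = refl
U₅-σ₅ a (suc n) = U₅-σ₅ (tail a) n

U₅-C⊛ : ∀ z a → U₅ (C z ⊛ a) ≈ C z ⊛ U₅ a
U₅-C⊛ z a = exactly λ n → trans (C-⊛ z a (n ℕ.* 5)) (sym (C-⊛ z (U₅ a) n))

U₅-q⁵ : ∀ a → U₅ (pow q 5 ⊛ a) ≈ q ⊛ U₅ a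
U₅-q⁵ a = ≈-trans
  (U₅-cong {pow q 5 ⊛ a} {q ⊛ (q ⊛ (q ⊛ (q ⊛ (q ⊛ a))))}
    (solve 2 (λ q a → q :^ 5 :* a := q :* (q :* (q :* (q :* (q :* a))))) ≈-refl q a))
  (exactly λ
    { zero    → trans (q-⊛-zero (q ⊛ (q ⊛ (q ⊛ (q ⊛ a))))) (sym (q-⊛-zero (U₅ a)))
    ; (suc n) → begin
        (q ⊛ (q ⊛ (q ⊛ (q ⊛ (q ⊛ a))))) (5 ℕ.+ n ℕ.* 5) ≡⟨ q-⊛-suc (q ⊛ (q ⊛ (q ⊛ (q ⊛ a)))) (4 ℕ.+ n ℕ.* 5) ⟩
        (q ⊛ (q ⊛ (q ⊛ (q ⊛ a)))) (4 ℕ.+ n ℕ.* 5)       ≡⟨ q-⊛-suc (q ⊛ (q ⊛ (q ⊛ a))) (3 ℕ.+ n ℕ.* 5) ⟩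
        (q ⊛ (q ⊛ (q ⊛ a))) (3 ℕ.+ n ℕ.* 5)             ≡⟨ q-⊛-suc (q ⊛ (q ⊛ a)) (2 ℕ.+ n ℕ.* 5) ⟩
        (q ⊛ (q ⊛ a)) (2 ℕ.+ n ℕ.* 5)                   ≡⟨ q-⊛-suc (q ⊛ a) (1 ℕ.+ n ℕ.* 5) ⟩
        (q ⊛ a) (1 ℕ.+ n ℕ.* 5)                         ≡⟨ q-⊛-suc a (n ℕ.* 5) ⟩
        a (n ℕ.* 5)                                     ≡⟨ q-⊛-suc (U₅ a) n ⟨
        (q ⊛ U₅ a) (suc n)                              ∎ })
  where open ≡-Reasoning

-- Series in `q⁵` are scalars for `U₅`: a factor `q⁵` inside becomes a factor `q` outside, and
-- coinduction on `b` extends this from powers of `q` to all series.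
U₅-⊛-σ₅ : ∀ a b → U₅ (a ⊛ σ₅ b) ≈ U₅ a ⊛ b
U₅-⊛-σ₅ a = coinduction (λ b → U₅ (a ⊛ σ₅ b)) (λ b → U₅ a ⊛ b) (λ b → C (b 0) ⊛ U₅ a) (λ _ → one) tail
  (λ b → begin
    U₅ (a ⊛ σ₅ b)
      ≈⟨ U₅-cong (⊛ˡ a (dilate-unfold 4 b)) ⟩
    U₅ (a ⊛ (C (b 0) ⊕ q ⊛ (pow q 4 ⊛ σ₅ (tail b))))
      ≈⟨ U₅-cong {a ⊛ (C (b 0) ⊕ q ⊛ (pow q 4 ⊛ σ₅ (tail b)))} {C (b 0) ⊛ a ⊕ pow q 5 ⊛ (a ⊛ σ₅ (tail b))}
           (solve 4 (λ a b q s → a :* (b :+ q :* (q :^ 4 :* s)) := b :* a :+ q :^ 5 :* (a :* s)) ≈-refl a (C (b 0)) q (σ₅ (tail b))) ⟩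
    U₅ (C (b 0) ⊛ a) ⊕ U₅ (pow q 5 ⊛ (a ⊛ σ₅ (tail b)))
      ≈⟨ ⊕-cong (U₅-C⊛ (b 0) a) (U₅-q⁵ (a ⊛ σ₅ (tail b))) ⟩
    C (b 0) ⊛ U₅ a ⊕ q ⊛ U₅ (a ⊛ σ₅ (tail b))
      ≈⟨ ⊕ˡ (C (b 0) ⊛ U₅ a) (⊛ˡ q (Ring.*-identityˡ (U₅ (a ⊛ σ₅ (tail b))))) ⟨
    C (b 0) ⊛ U₅ a ⊕ q ⊛ (one ⊛ U₅ (a ⊛ σ₅ (tail b))) ∎)
  (λ b → begin
    U₅ a ⊛ b
      ≈⟨ ⊛ˡ (U₅ a) (head-tail b) ⟩
    U₅ a ⊛ (C (b 0) ⊕ q ⊛ tail b)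
      ≈⟨ solve 4 (λ a b q s → a :* (b :+ q :* s) := b :* a :+ q :* (a :* s)) ≈-refl (U₅ a) (C (b 0)) q (tail b) ⟩
    C (b 0) ⊛ U₅ a ⊕ q ⊛ (U₅ a ⊛ tail b)
      ≈⟨ ⊕ˡ (C (b 0) ⊛ U₅ a) (⊛ˡ q (Ring.*-identityˡ (U₅ a ⊛ tail b))) ⟨
    C (b 0) ⊛ U₅ a ⊕ q ⊛ (one ⊛ (U₅ a ⊛ tail b)) ∎)
  where open ≈-Reasoning

module _ where
  private module Z = SeriesMod 0 (λ _ → ⊤) (λ _ _ → _)

  ~₀⇒≡ : ∀ {x y} → x Z.~ y → x ≡ y
  ~₀⇒≡ {x} {y} (Z.mod d) = ℤₚ.i-j≡0⇒i≡j x y (Signed.0∣⇒≡0 d)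

  -- An equality over the integers, since both sides are zero modulo 5 and carry information only
  -- after division by 5. Congruence modulo 0 is equality, which is why the solver is used with that
  -- modulus.
  θ-pow₅ : ∀ a → θ (pow a 5) ≗ scale (+ 5) (pow a 4 ⊛ θ a)
  θ-pow₅ a n = ~₀⇒≡ (Z.coeff e n _)
    where
    open Z.Solver using () renaming (solve to solve₀; con to con₀; _:+_ to _⊞_; _:*_ to _⊠_; _:^_ to _↑_; _:=_ to _≐_)
    step : ∀ k {b} → θ (pow a k) Z.≈ b → θ (pow a (suc k)) Z.≈ θ a ⊛ pow a k ⊕ a ⊛ b
    step k e = Z.≈-trans (Z.exactly (leibniz a (pow a k))) (Z.⊕ˡ (θ a ⊛ pow a k) (Z.⊛ˡ a e))
    e : θ (pow a 5) Z.≈ scale (+ 5) (pow a 4 ⊛ θ a)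
    e = Z.≈-trans (step 4 (step 3 (step 2 (step 1 (step 0 (Z.exactly θ-one))))))
      (Z.≈-trans (solve₀ 2 (λ t a →
          t ⊠ a ↑ 4 ⊞ a ⊠ (t ⊠ a ↑ 3 ⊞ a ⊠ (t ⊠ a ↑ 2 ⊞ a ⊠ (t ⊠ a ↑ 1 ⊞ a ⊠ (t ⊠ a ↑ 0 ⊞ a ⊠ con₀ (+ 0)))))
            ≐ con₀ (+ 5) ⊠ (a ↑ 4 ⊠ t)) Z.≈-refl (θ a) a)
        (Z.exactly (C-⊛ (+ 5) (pow a 4 ⊛ θ a))))

-- The Cartier operator fixes logarithmic derivatives: 5 a⁴ θa = θ(a⁵), and a⁵ ≡ a(q⁵).
cartier : ∀ a → U₅ (pow a 4 ⊛ θ a) ≈ θ a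
cartier a = at λ n _ → ~-trans (~-reflexive (exact n)) (~-* (~-refl {+ n})
  (~-trans (coeff (frobenius a) (n ℕ.* 5) _) (~-reflexive (U₅-σ₅ a n))))
  where
  exact : ∀ n → (pow a 4 ⊛ θ a) (n ℕ.* 5) ≡ + n * pow a 5 (n ℕ.* 5)
  exact n = ℤₚ.*-cancelˡ-≡ (+ 5) _ _ (begin
    + 5 * (pow a 4 ⊛ θ a) (n ℕ.* 5)    ≡⟨ θ-pow₅ a (n ℕ.* 5) ⟨
    + (n ℕ.* 5) * pow a 5 (n ℕ.* 5)    ≡⟨ cong (_* pow a 5 (n ℕ.* 5)) (ℤₚ.pos-* n 5) ⟩
    + n * + 5 * pow a 5 (n ℕ.* 5)      ≡⟨ lemma (+ n) (pow a 5 (n ℕ.* 5)) ⟩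
    + 5 * (+ n * pow a 5 (n ℕ.* 5))    ∎)
    where
    open ≡-Reasoning
    lemma : ∀ x y → x * + 5 * y ≡ + 5 * (x * y)
    lemma = solve-∀

-- Series determined by an equation with a factor of order 1

C0≡0 : ∀ n → C (+ 0) n ≡ + 0
C0≡0 zero    = refl
C0≡0 (suc n) = refl

⊛-vanish : ∀ a N {b} → Mod₅<._≈_ N b (C (+ 0)) → ∀ {n} → n ℕ.< N → (a ⊛ b) n ~ + 0
⊛-vanish a N e {n} n<N = ~-trans (Mod₅<.coeff (Mod₅<.⊛ˡ N a e) n n<N)
  (~-trans (coeff (Ring.zeroʳ a) n _) (~-reflexive (C0≡0 n)))

extend : ∀ {N b} → Mod₅<._≈_ N b (C (+ 0)) → b N ~ + 0 → Mod₅<._≈_ (suc N) b (C (+ 0))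
extend {N} {b} e e′ = Mod₅<.at λ n n<1+N → split n (ℕₚ.m<1+n⇒m<n∨m≡n n<1+N)
  where
  split : ∀ n → n ℕ.< N ⊎ n ≡ N → b n ~ C (+ 0) n
  split n (inj₁ n<N)  = Mod₅<.coeff e n n<N
  split n (inj₂ refl) = ~-trans e′ (~-reflexive (sym (C0≡0 n)))

private
  -- If `p` has no constant term and `d` vanishes below `N`, then `p 1 * d N` is the only product
  -- that survives at index `N + 1`.
  leading : ∀ p d N → p 0 ~ + 0 → Mod₅<._≈_ N d (C (+ 0)) → (p ⊛ d) (suc N) ~ p 1 * d N
  leading p d N p₀ e = ~-trans (~-reflexive (⊛-first p d N))
    (~-trans (~-+ (~-* p₀ (~-refl {d (suc N)})) (second N e)) (~-reflexive (ℤₚ.+-identityˡ _)))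
    where
    second : ∀ N → Mod₅<._≈_ N d (C (+ 0)) → (tail p ⊛ d) N ~ p 1 * d N
    second zero    e = ~-refl
    second (suc N) e = ~-trans (~-reflexive (⊛-first (tail p) d N))
      (~-trans (~-+ (~-refl {p 1 * d (suc N)}) (⊛-vanish (tail (tail p)) (suc N) e ℕₚ.≤-refl)) (~-reflexive (ℤₚ.+-identityʳ _)))

  unit-cancel : ∀ c {x y} → c * x ~ + 1 → x * y ~ + 0 → y ~ + 0
  unit-cancel c {x} {y} e e′ = ~-trans (~-reflexive (sym (ℤₚ.*-identityˡ y)))
    (~-trans (~-* (~-sym e) (~-refl {y})) (~-trans (~-reflexive (ℤₚ.*-assoc c x y))
      (~-trans (~-* (~-refl {c}) e′) (~-reflexive (ℤₚ.*-zeroʳ c)))))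

-- A series of order exactly 1 is not a unit but is no zero divisor either. With `c` inverting its
-- leading coefficient modulo 5, the coefficients of `d` vanish one after the other.
⊛-cancel-zero : ∀ p d c → p 0 ~ + 0 → c * p 1 ~ + 1 → p ⊛ d ≈ C (+ 0) → d ≈ C (+ 0)
⊛-cancel-zero p d c p₀ p₁ e = untruncate go
  where
  go : ∀ N → Mod₅<._≈_ N d (C (+ 0))
  go zero    = Mod₅<.at λ _ ()
  go (suc N) = extend (go N) (unit-cancel c p₁ (~-trans (~-sym (leading p d N p₀ (go N))) (coeff e (suc N) _)))

-- Order `N + 2` doubles to `2N + 4`. The weaker bound `N + 4` already exceeds `N + 3`, the index at
-- which `⊛-σ₂-unique` reads off the coefficient `d (N + 2)`.
σ₂-vanish : ∀ N {a} → Mod₅<._≈_ (2 ℕ.+ N) a (C (+ 0)) → Mod₅<._≈_ (4 ℕ.+ N) (σ₂ a) (C (+ 0))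
σ₂-vanish N {a} e = Mod₅<.at λ
  { 0 _ → Mod₅<.coeff e 0 (s≤s z≤n)
  ; 1 _ → ~-refl
  ; 2 _ → Mod₅<.coeff e 1 (s≤s (s≤s z≤n))
  ; 3 _ → ~-refl
  ; (suc (suc (suc (suc n)))) (s≤s (s≤s (s≤s (s≤s n<N)))) → ~-trans
      (Mod₅<.coeff (Mod₅<.≈-trans N
        (Sub₂.S-cong< N {tail (tail a)} {C (+ 0)} (Mod₅<.at λ i i<N →
          ~-trans (Mod₅<.coeff e (2 ℕ.+ i) (s≤s (s≤s i<N))) (~-reflexive (sym (C0≡0 i)))))
        (truncate N Sub₂.S-zero)) n n<N)
      (~-reflexive (C0≡0 n)) }

-- A solution of p(q) d(q) = v(q) d(q²), with p of order exactly 1, is determined by its first two coefficients.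
⊛-σ₂-unique : ∀ p v d c → p 0 ~ + 0 → c * p 1 ~ + 1 → p ⊛ d ≈ v ⊛ σ₂ d →
  d 0 ~ + 0 → d 1 ~ + 0 → d ≈ C (+ 0)
⊛-σ₂-unique p v d c p₀ p₁ e d₀ d₁ = untruncate λ N → Mod₅<.at λ n n<N → Mod₅<.coeff (go N) n (ℕₚ.m≤n⇒m≤o+n 2 n<N)
  where
  go : ∀ N → Mod₅<._≈_ (2 ℕ.+ N) d (C (+ 0))
  go zero    = extend (extend (Mod₅<.at λ _ ()) d₀) d₁
  go (suc N) = extend (go N) (unit-cancel c p₁ (~-trans (~-sym (leading p d (2 ℕ.+ N) p₀ (go N)))
    (~-trans (coeff e (3 ℕ.+ N) _) (⊛-vanish v (4 ℕ.+ N) (σ₂-vanish N (go N)) ℕₚ.≤-refl))))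

-- Products and theta series

infix 4 _≈[_]_
_≈[_]_ : Series → ℕ → Series → Set
a ≈[ N ] b = Mod₅<._≈_ N a b

weaken : ∀ {M N a b} → M ℕ.≤ N → a ≈[ N ] b → a ≈[ M ] b
weaken M≤N e = Mod₅<.at λ n n<M → Mod₅<.coeff e n (ℕₚ.≤-trans n<M M≤N)

pow-+ : ∀ a m n → pow a (m ℕ.+ n) ≈ pow a m ⊛ pow a n
pow-+ a zero    n = ≈-sym (Ring.*-identityˡ (pow a n))
pow-+ a (suc m) n = ≈-trans (⊛ˡ a (pow-+ a m n)) (≈-sym (Ring.*-assoc a (pow a m) (pow a n)))

pow-≡ : ∀ a {m n} → m ≡ n → pow a m ≈ pow a n
pow-≡ a refl = ≈-refl

pow-q-zero : ∀ {N j} → N ℕ.≤ j → pow q j ≈[ N ] C (+ 0)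
pow-q-zero z≤n = Mod₅<.at λ _ ()
pow-q-zero {suc N} {suc j} (s≤s N≤j) = Mod₅<.≈-trans (suc N) (q-⊛-cong< (pow-q-zero N≤j))
  (truncate (suc N) (Ring.zeroʳ q))

mono≈pow : ∀ j → mono j ≈ pow q j
mono≈pow zero    = exactly λ { zero → refl ; (suc n) → refl }
mono≈pow (suc j) = ≈-trans
  (exactly λ { zero → sym (q-⊛-zero (mono j)) ; (suc n) → sym (q-⊛-suc (mono j) n) })
  (⊛ˡ q (mono≈pow j))

oneMinus≈ : ∀ j → oneMinus j ≈ one ⊕ ⊝ pow q j
oneMinus≈ j = ⊕ˡ one (⊝-cong (mono≈pow j))

oneMinus-one : ∀ {N j} → N ℕ.≤ j → oneMinus j ≈[ N ] one
oneMinus-one {N} {j} N≤j = M.≈-trans (truncate N (oneMinus≈ j)) (M.≈-trans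
  (M.⊕ˡ one (M.⊝-cong (pow-q-zero N≤j)))
  (truncate N (solve 1 (λ x → x :+ :- con (+ 0) := x) ≈-refl one)))
  where module M = Mod₅< N

pow-q-⊛-below : ∀ j a {n} → n ℕ.< j → (pow q j ⊛ a) n ~ + 0
pow-q-⊛-below j a {n} n<j = ~-trans (Mod₅<.coeff (Mod₅<.⊛ʳ j (pow-q-zero {j} ℕₚ.≤-refl) a) n n<j)
  (~-trans (coeff (Ring.zeroˡ a) n _) (~-reflexive (C0≡0 n)))

pow-q-⊛ : ∀ j a n → (pow q j ⊛ a) (j ℕ.+ n) ~ a n
pow-q-⊛ zero    a n = coeff (Ring.*-identityˡ a) n _
pow-q-⊛ (suc j) a n = ~-trans (coeff (Ring.*-assoc q (pow q j) a) (suc j ℕ.+ n) _)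
  (~-trans (~-reflexive (q-⊛-suc (pow q j ⊛ a) (j ℕ.+ n))) (pow-q-⊛ j a n))

geomInv-unfold : ∀ j → geomInv (suc j) ≈ one ⊕ pow q (suc j) ⊛ geomInv (suc j)
geomInv-unfold j = at λ n _ → split n (ℕₚ.<-≤-connex n k)
  where
  k = suc j
  below : ∀ n → n ℕ.< k → geomInv k n ≡ one n
  below zero    _   = cong (λ b → if b then + 1 else + 0) (dec-true (k ℕ∣.∣? 0) (k ℕ∣.∣0))
  below (suc n) n<k = cong (λ b → if b then + 1 else + 0) (dec-false (k ℕ∣.∣? suc n) (ℕ∣.>⇒∤ n<k))
  above : ∀ n → geomInv k (k ℕ.+ n) ≡ geomInv k n
  above n = cong (λ b → if b then + 1 else + 0) (does-⇔
    (mk⇔ (λ d → ℕ∣.∣m+n∣m⇒∣n d ℕ∣.∣-refl) (ℕ∣.∣m∣n⇒∣m+n ℕ∣.∣-refl)) (k ℕ∣.∣? (k ℕ.+ n)) (k ℕ∣.∣? n))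
  split : ∀ n → n ℕ.< k ⊎ k ℕ.≤ n → geomInv k n ~ one n + (pow q k ⊛ geomInv k) n
  split n (inj₁ n<k) = ~-trans (~-reflexive (trans (below n n<k) (sym (ℤₚ.+-identityʳ (one n)))))
    (~-+ (~-refl {one n}) (~-sym (pow-q-⊛-below k (geomInv k) n<k)))
  split n (inj₂ k≤n) = subst (λ n → geomInv k n ~ one n + (pow q k ⊛ geomInv k) n) (ℕₚ.m+[n∸m]≡n k≤n)
    (~-trans (~-reflexive (trans (above (n ℕ.∸ k)) (sym (ℤₚ.+-identityˡ _))))
      (~-+ (~-refl {+ 0}) (~-sym (pow-q-⊛ k (geomInv k) (n ℕ.∸ k)))))

oneMinus-geomInv : ∀ j → oneMinus (suc j) ⊛ geomInv (suc j) ≈ one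
oneMinus-geomInv j = begin
  oneMinus (suc j) ⊛ g                       ≈⟨ ⊛ʳ (oneMinus≈ (suc j)) g ⟩
  (one ⊕ ⊝ x) ⊛ g                            ≈⟨ solve 2 (λ x g → (x :^ 0 :+ :- x) :* g := g :+ :- (x :* g)) ≈-refl x g ⟩
  g ⊕ ⊝ (x ⊛ g)                              ≈⟨ ⊕ʳ (geomInv-unfold j) (⊝ (x ⊛ g)) ⟩
  (one ⊕ x ⊛ g) ⊕ ⊝ (x ⊛ g)                  ≈⟨ solve 2 (λ x g → (x :^ 0 :+ x :* g) :+ :- (x :* g) := x :^ 0) ≈-refl x g ⟩
  one                                        ∎
  where
  open ≈-Reasoning
  g = geomInv (suc j)
  x = pow q (suc j)

geomInv-one : ∀ {N j} → N ℕ.≤ suc j → geomInv (suc j) ≈[ N ] one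
geomInv-one {N} {j} N≤j = M.≈-trans (truncate N (geomInv-unfold j)) (M.≈-trans
  (M.⊕ˡ one (M.⊛ʳ (pow-q-zero N≤j) (geomInv (suc j))))
  (truncate N (solve 2 (λ x g → x :+ con (+ 0) :* g := x) ≈-refl one (geomInv (suc j)))))
  where module M = Mod₅< N

-- The diagonal, which is the form in which `f` and `fInv` are defined; `limit≈` justifies it when
-- stage `N + 1` changes nothing up to `q^N`.
limit : (ℕ → Series) → Series
limit X n = X n n

limit≈ : ∀ X → (∀ N → X (suc N) ≈[ suc N ] X N) → ∀ N → limit X ≈[ suc N ] X N
limit≈ X stable N = Mod₅<.at λ n n<1+N → ~-sym (go N n (ℕₚ.≤-pred n<1+N))
  where
  go : ∀ N n → n ℕ.≤ N → X N n ~ X n n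
  go zero    .zero z≤n = ~-refl
  go (suc N) n     n≤N with ℕₚ.m≤n⇒m<n∨m≡n n≤N
  ... | inj₁ n<1+N = ~-trans (Mod₅<.coeff (stable N) n n<1+N) (go N n (ℕₚ.≤-pred n<1+N))
  ... | inj₂ refl  = ~-refl

prodTo-limit : ∀ g → (∀ N → g (suc N) ≈[ suc N ] one) → ∀ N → limit (λ N → prodTo N g) ≈[ suc N ] prodTo N g
prodTo-limit g e = limit≈ (λ N → prodTo N g) λ N → Mod₅<.≈-trans (suc N)
  (Mod₅<.⊛ˡ (suc N) (prodTo N g) (e N)) (truncate (suc N) (Ring.*-identityʳ (prodTo N g)))

f-limit : ∀ k N → f (suc k) ≈[ suc N ] prodTo N (λ m → oneMinus (suc k ℕ.* m))
f-limit k = prodTo-limit (λ m → oneMinus (suc k ℕ.* m)) λ N → oneMinus-one (ℕₚ.m≤m+n (suc N) (k ℕ.* suc N))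

fInv-limit : ∀ k N → fInv (suc k) ≈[ suc N ] prodTo N (λ m → geomInv (suc k ℕ.* m))
fInv-limit k = prodTo-limit (λ m → geomInv (suc k ℕ.* m)) λ N → geomInv-one (ℕₚ.m≤m+n (suc N) (k ℕ.* suc N))

f-fInv : ∀ k → f (suc k) ⊛ fInv (suc k) ≈ one
f-fInv k = untruncate λ N → weaken (ℕₚ.n≤1+n N) (Mod₅<.≈-trans (suc N)
  (Mod₅<.⊛-cong (suc N) (f-limit k N) (fInv-limit k N)) (truncate (suc N) (inverse N)))
  where
  inverse : ∀ N → prodTo N (λ m → oneMinus (suc k ℕ.* m)) ⊛ prodTo N (λ m → geomInv (suc k ℕ.* m)) ≈ one
  inverse zero    = Ring.*-identityˡ one
  inverse (suc N) = ≈-trans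
    (solve 4 (λ a b c d → (a :* b) :* (c :* d) := (a :* c) :* (b :* d)) ≈-refl
      (prodTo N (λ m → oneMinus (suc k ℕ.* m))) (oneMinus (suc k ℕ.* suc N))
      (prodTo N (λ m → geomInv (suc k ℕ.* m))) (geomInv (suc k ℕ.* suc N)))
    (≈-trans (⊛-cong (inverse N) (oneMinus-geomInv (N ℕ.+ k ℕ.* suc N))) (Ring.*-identityˡ one))

σ₂-pow-q : ∀ j → σ₂ (pow q j) ≈ pow q j ⊛ pow q j
σ₂-pow-q zero    = ≈-trans Sub₂.S-one (≈-sym (Ring.*-identityˡ one))
σ₂-pow-q (suc j) = ≈-trans (Sub₂.S-⊛ q (pow q j)) (≈-trans (⊛-cong Sub₂.S-q (σ₂-pow-q j))
  (solve 2 (λ q x → (q :* q :^ 1) :* (x :* x) := (q :* x) :* (q :* x)) ≈-refl q (pow q j)))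

σ₂-1-q : ∀ j → σ₂ (one ⊕ ⊝ pow q j) ≈ one ⊕ ⊝ (pow q j ⊛ pow q j)
σ₂-1-q j = ≈-trans (Sub₂.S-⊕ one (⊝ pow q j)) (⊕-cong Sub₂.S-one
  (≈-trans (Sub₂.S-⊝ (pow q j)) (⊝-cong (σ₂-pow-q j))))

σ₂-f : ∀ k → σ₂ (f (suc k)) ≈ f (2 ℕ.* suc k)
σ₂-f k = untruncate λ N → weaken (ℕₚ.n≤1+n N) (Mod₅<.≈-trans (suc N)
  (Sub₂.S-cong< (suc N) (f-limit k N))
  (Mod₅<.≈-trans (suc N) (truncate (suc N) (finite N)) (Mod₅<.≈-sym (suc N) (f-limit (k ℕ.+ 1 ℕ.* suc k) N))))
  where
  finite : ∀ N → σ₂ (prodTo N (λ m → oneMinus (suc k ℕ.* m))) ≈ prodTo N (λ m → oneMinus (2 ℕ.* suc k ℕ.* m))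
  finite zero    = Sub₂.S-one
  finite (suc N) = ≈-trans (Sub₂.S-⊛ (prodTo N (λ m → oneMinus (suc k ℕ.* m))) (oneMinus (suc k ℕ.* suc N)))
    (⊛-cong (finite N) (begin
      σ₂ (oneMinus j)                  ≈⟨ Sub₂.S-cong (oneMinus≈ j) ⟩
      σ₂ (one ⊕ ⊝ pow q j)             ≈⟨ σ₂-1-q j ⟩
      one ⊕ ⊝ (pow q j ⊛ pow q j)      ≈⟨ ⊕ˡ one (⊝-cong (pow-+ q j j)) ⟨
      one ⊕ ⊝ pow q (j ℕ.+ j)          ≈⟨ ⊕ˡ one (⊝-cong (pow-≡ q (cong (j ℕ.+_) (sym (ℕₚ.+-identityʳ j))))) ⟩
      one ⊕ ⊝ pow q (2 ℕ.* j)          ≈⟨ ⊕ˡ one (⊝-cong (pow-≡ q (sym (ℕₚ.*-assoc 2 (suc k) (suc N))))) ⟩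
      one ⊕ ⊝ pow q (2 ℕ.* suc k ℕ.* suc N) ≈⟨ oneMinus≈ (2 ℕ.* suc k ℕ.* suc N) ⟨
      oneMinus (2 ℕ.* suc k ℕ.* suc N) ∎))
    where
    open ≈-Reasoning
    j = suc k ℕ.* suc N

-- (q^(s+1); q)_d
poch : ℕ → ℕ → Series
poch s zero    = one
poch s (suc d) = (one ⊕ ⊝ pow q (suc (s ℕ.+ d))) ⊛ poch s d

poch-shift : ∀ s d → poch s (suc d) ≈ (one ⊕ ⊝ pow q (suc s)) ⊛ poch (suc s) d
poch-shift s zero    = ⊛ʳ (⊕ˡ one (⊝-cong (pow-≡ q (cong suc (ℕₚ.+-identityʳ s))))) one
poch-shift s (suc d) = ≈-trans
  (⊛-cong (⊕ˡ one (⊝-cong (pow-≡ q (cong suc (ℕₚ.+-suc s d))))) (poch-shift s d))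
  (solve 3 (λ x y z → x :* (y :* z) := y :* (x :* z)) ≈-refl
    (one ⊕ ⊝ pow q (suc (suc s ℕ.+ d))) (one ⊕ ⊝ pow q (suc s)) (poch (suc s) d))

f₁-limit : ∀ N → f 1 ≈[ suc N ] poch 0 N
f₁-limit N = Mod₅<.≈-trans (suc N) (f-limit 0 N) (truncate (suc N) (finite N))
  where
  finite : ∀ N → prodTo N (λ m → oneMinus (1 ℕ.* m)) ≈ poch 0 N
  finite zero    = ≈-refl
  finite (suc N) = ≈-trans (⊛-cong (finite N)
      (≈-trans (oneMinus≈ (1 ℕ.* suc N)) (⊕ˡ one (⊝-cong (pow-≡ q (ℕₚ.*-identityˡ (suc N)))))))
    (Ring.*-comm (poch 0 N) (one ⊕ ⊝ pow q (suc N)))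

-- (-q; q)_n
poch⁺ : ℕ → Series
poch⁺ zero    = one
poch⁺ (suc n) = (one ⊕ pow q (suc n)) ⊛ poch⁺ n

poch-poch⁺ : ∀ n → poch 0 n ⊛ poch⁺ n ≈ σ₂ (poch 0 n)
poch-poch⁺ zero    = ≈-trans (Ring.*-identityˡ one) (≈-sym Sub₂.S-one)
poch-poch⁺ (suc n) = begin
  ((one ⊕ ⊝ x) ⊛ poch 0 n) ⊛ ((one ⊕ x) ⊛ poch⁺ n)
    ≈⟨ solve 3 (λ x p r → ((x :^ 0 :+ :- x) :* p) :* ((x :^ 0 :+ x) :* r) := (x :^ 0 :+ :- (x :* x)) :* (p :* r)) ≈-refl x (poch 0 n) (poch⁺ n) ⟩
  (one ⊕ ⊝ (x ⊛ x)) ⊛ (poch 0 n ⊛ poch⁺ n)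
    ≈⟨ ⊛-cong (≈-sym (σ₂-1-q (suc n))) (poch-poch⁺ n) ⟩
  σ₂ (one ⊕ ⊝ x) ⊛ σ₂ (poch 0 n)
    ≈⟨ Sub₂.S-⊛ (one ⊕ ⊝ x) (poch 0 n) ⟨
  σ₂ ((one ⊕ ⊝ x) ⊛ poch 0 n) ∎
  where
  open ≈-Reasoning
  x = pow q (suc n)

-- 1 + 2 Σ_{1 ≤ s ≤ n} εˢ q^(s²), with limits φ(q) and φ(-q) for ε = ±1
Θ : Series → ℕ → Series
Θ ε zero    = one
Θ ε (suc n) = Θ ε n ⊕ C (+ 2) ⊛ (pow ε (suc n) ⊛ pow q (suc n ℕ.* suc n))

φ : Series → Series
φ ε = limit (Θ ε)

φ-limit : ∀ ε N → φ ε ≈[ suc N ] Θ ε N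
φ-limit ε = limit≈ (Θ ε) λ N → let module M = Mod₅< (suc N) in M.≈-trans
  (M.⊕ˡ (Θ ε N) (M.⊛ˡ (C (+ 2)) (M.⊛ˡ (pow ε (suc N)) (pow-q-zero (ℕₚ.m≤m+n (suc N) (N ℕ.* suc N))))))
  (truncate (suc N) (solve 2 (λ x y → x :+ con (+ 2) :* (y :* con (+ 0)) := x) ≈-refl (Θ ε N) (pow ε (suc N))))

-- Shanks' finite form of Gauss's identity φ(-q) = f₁² / f₂.
module Shanks where

  ε = C (- + 1)

  c : ℕ → ℕ → Series
  c s d = pow q (s ℕ.* suc (s ℕ.+ d)) ⊛ poch s d

  t : ℕ → ℕ → Series
  t k d = C (+ 2) ⊛ (pow ε (suc k) ⊛ (poch⁺ k ⊛ c (suc k) d))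

  r : ℕ → ℕ → Series
  r k d = C (+ 2) ⊛ (pow ε k ⊛ (poch⁺ k ⊛ c k d))

  -- For `n = k + d`, the partial sum up to `s = k` of `(q;q)_n` plus the terms `2 (-1)^s
  -- (-q;q)_(s-1) q^(s(n+1)) (q^(s+1);q)_(n-s)`. Carrying `d` in place of `n` avoids subtraction.
  S : ℕ → ℕ → Series
  S zero    d = poch 0 d
  S (suc k) d = S k (suc d) ⊕ t k d

  c-suc-left : ∀ k d → pow q (suc (suc k ℕ.+ d)) ⊛ c k (suc d) ≈ (one ⊕ ⊝ pow q (suc k)) ⊛ c (suc k) d
  c-suc-left k d = begin
    pow q X ⊛ (pow q (k ℕ.* suc (k ℕ.+ suc d)) ⊛ poch k (suc d))
      ≈⟨ ⊛ˡ (pow q X) (⊛-cong (pow-≡ q (cong (λ u → k ℕ.* suc u) (ℕₚ.+-suc k d))) (poch-shift k d)) ⟩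
    pow q X ⊛ (pow q (k ℕ.* X) ⊛ (y ⊛ p))
      ≈⟨ solve 4 (λ a b y p → a :* (b :* (y :* p)) := y :* ((a :* b) :* p)) ≈-refl (pow q X) (pow q (k ℕ.* X)) y p ⟩
    y ⊛ ((pow q X ⊛ pow q (k ℕ.* X)) ⊛ p)
      ≈⟨ ⊛ˡ y (⊛ʳ (pow-+ q X (k ℕ.* X)) p) ⟨
    y ⊛ (pow q (suc k ℕ.* X) ⊛ p) ∎
    where
    open ≈-Reasoning
    X = suc (suc k ℕ.+ d)
    y = one ⊕ ⊝ pow q (suc k)
    p = poch (suc k) d

  c-suc-right : ∀ s d → c s (suc d) ≈ pow q s ⊛ ((one ⊕ ⊝ pow q (suc (s ℕ.+ d))) ⊛ c s d)
  c-suc-right s d = begin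
    pow q (s ℕ.* suc (s ℕ.+ suc d)) ⊛ (y ⊛ poch s d)
      ≈⟨ ⊛ʳ (pow-≡ q (trans (cong (λ u → s ℕ.* suc u) (ℕₚ.+-suc s d)) (ℕₚ.*-suc s X))) (y ⊛ poch s d) ⟩
    pow q (s ℕ.+ s ℕ.* X) ⊛ (y ⊛ poch s d)
      ≈⟨ ⊛ʳ (pow-+ q s (s ℕ.* X)) (y ⊛ poch s d) ⟩
    (pow q s ⊛ pow q (s ℕ.* X)) ⊛ (y ⊛ poch s d)
      ≈⟨ solve 4 (λ a b y p → (a :* b) :* (y :* p) := a :* (y :* (b :* p))) ≈-refl (pow q s) (pow q (s ℕ.* X)) y (poch s d) ⟩
    pow q s ⊛ (y ⊛ (pow q (s ℕ.* X) ⊛ poch s d)) ∎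
    where
    open ≈-Reasoning
    X = suc (s ℕ.+ d)
    y = one ⊕ ⊝ pow q X

  -- Raising `n = k + d` by one multiplies the partial sum by `1 + q^(n+1)`, up to one boundary
  -- term. The induction on `k` telescopes: the boundary term for `k` and the change in the newly
  -- added term combine into the boundary term for `k + 1`.
  S-suc : ∀ k d → S k (suc d) ≈ (one ⊕ pow q (suc (k ℕ.+ d))) ⊛ S k d ⊕ ⊝ (pow q (suc (k ℕ.+ d)) ⊛ r k d)
  S-suc zero    d = solve 2 (λ x p → (x :^ 0 :+ :- x) :* p :=
      (x :^ 0 :+ x) :* p :+ :- (x :* (con (+ 2) :* (x :^ 0 :* (x :^ 0 :* (x :^ 0 :* p))))))
    ≈-refl (pow q (suc d)) (poch 0 d)
  S-suc (suc k) d = begin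
    S k (suc (suc d)) ⊕ t k (suc d)
      ≈⟨ ⊕-cong (S-suc k (suc d)) (⊛ˡ (C (+ 2)) (⊛ˡ (pow ε (suc k)) (⊛ˡ Q (c-suc-right (suc k) d)))) ⟩
    ((one ⊕ pow q (suc (k ℕ.+ suc d))) ⊛ S k (suc d) ⊕ ⊝ (pow q (suc (k ℕ.+ suc d)) ⊛ r k (suc d))) ⊕ t'
      ≈⟨ ⊕ʳ (⊕-cong (⊛ʳ (⊕ˡ one x≈) (S k (suc d))) (⊝-cong (⊛ʳ x≈ (r k (suc d))))) t' ⟩
    ((one ⊕ x) ⊛ S k (suc d) ⊕ ⊝ (x ⊛ r k (suc d))) ⊕ t'
      ≈⟨ solve 8 (λ x s e Q c₀ y c₁ o → ((o :+ x) :* s :+ :- (x :* (con (+ 2) :* (e :* (Q :* c₀))))) :+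
             con (+ 2) :* ((con (- + 1) :* e) :* (Q :* (y :* ((o :+ :- x) :* c₁)))) :=
           ((o :+ x) :* s :+ :- (con (+ 2) :* (e :* (Q :* (x :* c₀))))) :+
             con (+ 2) :* ((con (- + 1) :* e) :* (Q :* (y :* ((o :+ :- x) :* c₁))))) ≈-refl
           x (S k (suc d)) (pow ε k) Q (c k (suc d)) y c₁ one ⟩
    ((one ⊕ x) ⊛ S k (suc d) ⊕ ⊝ (C (+ 2) ⊛ (pow ε k ⊛ (Q ⊛ (x ⊛ c k (suc d)))))) ⊕ t'
      ≈⟨ ⊕ʳ (⊕ˡ ((one ⊕ x) ⊛ S k (suc d)) (⊝-cong (⊛ˡ (C (+ 2)) (⊛ˡ (pow ε k) (⊛ˡ Q (c-suc-left k d)))))) t' ⟩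
    ((one ⊕ x) ⊛ S k (suc d) ⊕ ⊝ (C (+ 2) ⊛ (pow ε k ⊛ (Q ⊛ ((one ⊕ ⊝ y) ⊛ c₁))))) ⊕ t'
      ≈⟨ solve 6 (λ x s e Q y c₁ → ((x :^ 0 :+ x) :* s :+ :- (con (+ 2) :* (e :* (Q :* ((x :^ 0 :+ :- y) :* c₁))))) :+
             con (+ 2) :* ((con (- + 1) :* e) :* (Q :* (y :* ((x :^ 0 :+ :- x) :* c₁)))) :=
           (x :^ 0 :+ x) :* (s :+ con (+ 2) :* ((con (- + 1) :* e) :* (Q :* c₁))) :+
             :- (x :* (con (+ 2) :* ((con (- + 1) :* e) :* (((x :^ 0 :+ y) :* Q) :* c₁))))) ≈-refl
           x (S k (suc d)) (pow ε k) Q y c₁ ⟩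
    (one ⊕ x) ⊛ (S k (suc d) ⊕ t k d) ⊕ ⊝ (x ⊛ r (suc k) d) ∎
    where
    open ≈-Reasoning
    x = pow q (suc (suc k ℕ.+ d))
    y = pow q (suc k)
    Q = poch⁺ k
    c₁ = c (suc k) d
    t' = C (+ 2) ⊛ (pow ε (suc k) ⊛ (Q ⊛ (y ⊛ ((one ⊕ ⊝ x) ⊛ c₁))))
    x≈ : pow q (suc (k ℕ.+ suc d)) ≈ x
    x≈ = pow-≡ q (cong suc (ℕₚ.+-suc k d))

  -- For the complete sum, the boundary term contributes the exponent `(n+1)²` and the new last term
  -- the exponent `(n+1)² + (n+1)`. Together they give `(1 + q^(n+1)) q^(n+1)²`, and in this way the
  -- squares of the theta series arise.
  poch⁺-Θ : ∀ n → poch⁺ n ⊛ Θ ε n ≈ S n 0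
  poch⁺-Θ zero    = Ring.*-identityˡ one
  poch⁺-Θ (suc n) = ≈-sym (begin
    S n 1 ⊕ t n 0
      ≈⟨ ⊕-cong (S-suc n 0) (⊛ˡ (C (+ 2)) (⊛ˡ (pow ε (suc n)) (⊛ˡ Q (⊛ʳ c₁≈ one)))) ⟩
    ((one ⊕ pow q (suc (n ℕ.+ 0))) ⊛ S n 0 ⊕ ⊝ (pow q (suc (n ℕ.+ 0)) ⊛ r n 0)) ⊕ t'
      ≈⟨ ⊕ʳ (⊕-cong (⊛-cong (⊕ˡ one z≈) (≈-sym (poch⁺-Θ n)))
           (⊝-cong (⊛-cong z≈ (⊛ˡ (C (+ 2)) (⊛ˡ (pow ε n) (⊛ˡ Q (⊛ʳ c₀≈ one))))))) t' ⟩
    ((one ⊕ z) ⊛ (Q ⊛ Θ ε n) ⊕ ⊝ (z ⊛ (C (+ 2) ⊛ (pow ε n ⊛ (Q ⊛ (w ⊛ one)))))) ⊕ t'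
      ≈⟨ solve 5 (λ z Q T e w →
           ((z :^ 0 :+ z) :* (Q :* T) :+ :- (z :* (con (+ 2) :* (e :* (Q :* (w :* z :^ 0)))))) :+
             con (+ 2) :* ((con (- + 1) :* e) :* (Q :* ((z :* (z :* w)) :* z :^ 0))) :=
           ((z :^ 0 :+ z) :* Q) :* (T :+ con (+ 2) :* ((con (- + 1) :* e) :* (z :* w)))) ≈-refl
           z Q (Θ ε n) (pow ε n) w ⟩
    ((one ⊕ z) ⊛ Q) ⊛ (Θ ε n ⊕ C (+ 2) ⊛ (pow ε (suc n) ⊛ (z ⊛ w)))
      ≈⟨ ⊛ˡ ((one ⊕ z) ⊛ Q) (⊕ˡ (Θ ε n) (⊛ˡ (C (+ 2)) (⊛ˡ (pow ε (suc n)) (≈-sym (pow-+ q (suc n) (n ℕ.* suc n)))))) ⟩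
    ((one ⊕ z) ⊛ Q) ⊛ Θ ε (suc n) ∎)
    where
    open ≈-Reasoning
    z = pow q (suc n)
    w = pow q (n ℕ.* suc n)
    Q = poch⁺ n
    t' = C (+ 2) ⊛ (pow ε (suc n) ⊛ (Q ⊛ ((z ⊛ (z ⊛ w)) ⊛ one)))
    z≈ : pow q (suc (n ℕ.+ 0)) ≈ z
    z≈ = pow-≡ q (cong suc (ℕₚ.+-identityʳ n))
    c₀≈ : pow q (n ℕ.* suc (n ℕ.+ 0)) ≈ w
    c₀≈ = pow-≡ q (cong (λ u → n ℕ.* suc u) (ℕₚ.+-identityʳ n))
    c₁≈ : pow q (suc n ℕ.* suc (suc n ℕ.+ 0)) ≈ z ⊛ (z ⊛ w)
    c₁≈ = ≈-trans (pow-≡ q (trans (cong (λ u → suc n ℕ.* suc (suc u)) (ℕₚ.+-identityʳ n)) (ℕₚ.*-suc (suc n) (suc n))))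
      (≈-trans (pow-+ q (suc n) (suc n ℕ.* suc n)) (⊛ˡ z (pow-+ q (suc n) (n ℕ.* suc n))))

  -- Each added term is divisible by `q^(n+1)` with `n` the total `suc k + d`, so modulo that power
  -- only the initial product remains.
  S-poch : ∀ k d → S k d ≈[ suc (k ℕ.+ d) ] poch 0 (k ℕ.+ d)
  S-poch zero    d = Mod₅<.≈-refl (suc d)
  S-poch (suc k) d = M.≈-trans (M.⊕-cong {S k (suc d)} {poch 0 (suc (k ℕ.+ d))}
      (subst (λ u → S k (suc d) ≈[ suc u ] poch 0 u) (ℕₚ.+-suc k d) (S-poch k (suc d)))
      (M.⊛ˡ (C (+ 2)) (M.⊛ˡ (pow ε (suc k)) (M.⊛ˡ (poch⁺ k)
        (M.⊛ʳ (pow-q-zero (ℕₚ.m≤m+n N (k ℕ.* N))) (poch (suc k) d))))))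
    (truncate N (solve 4 (λ x e Q p → x :+ con (+ 2) :* (e :* (Q :* (con (+ 0) :* p))) := x) ≈-refl
      (poch 0 (suc (k ℕ.+ d))) (pow ε (suc k)) (poch⁺ k) (poch (suc k) d)))
    where
    N = suc (suc k ℕ.+ d)
    module M = Mod₅< N

-- Modulo `q^(N+1)` the complete Shanks sum is both `(q;q)_N` and `(-q;q)_N` times the partial theta
-- sum. Multiplying by `(q;q)_N` merges the two products into `(q²;q²)_N`.
gauss : φ (C (- + 1)) ⊛ f 2 ≈ f 1 ⊛ f 1
gauss = untruncate λ N → weaken (ℕₚ.n≤1+n N) (finite N)
  where
  open Shanks
  finite : ∀ N → φ ε ⊛ f 2 ≈[ suc N ] f 1 ⊛ f 1
  finite N = M.≈-sym (begin
    f 1 ⊛ f 1                          ≈⟨ M.⊛-cong (f₁-limit N) (f₁-limit N) ⟩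
    p ⊛ p                              ≈⟨ M.⊛ˡ p (subst (λ u → S N 0 ≈[ suc u ] poch 0 u) (ℕₚ.+-identityʳ N) (S-poch N 0)) ⟨
    p ⊛ S N 0                          ≈⟨ truncate (suc N) (⊛ˡ p (poch⁺-Θ N)) ⟨
    p ⊛ (poch⁺ N ⊛ Θ ε N)              ≈⟨ truncate (suc N) (≈-sym (Ring.*-assoc p (poch⁺ N) (Θ ε N))) ⟩
    (p ⊛ poch⁺ N) ⊛ Θ ε N              ≈⟨ truncate (suc N) (⊛ʳ (poch-poch⁺ N) (Θ ε N)) ⟩
    σ₂ p ⊛ Θ ε N                       ≈⟨ M.⊛-cong (Sub₂.S-cong< (suc N) (f₁-limit N)) (φ-limit ε N) ⟨
    σ₂ (f 1) ⊛ φ ε                     ≈⟨ truncate (suc N) (⊛ʳ (σ₂-f 0) (φ ε)) ⟩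
    f 2 ⊛ φ ε                          ≈⟨ truncate (suc N) (Ring.*-comm (f 2) (φ ε)) ⟩
    φ ε ⊛ f 2                          ∎)
    where
    module M = Mod₅< (suc N)
    open M.≈-Reasoning
    p = poch 0 N

pow-one : ∀ n → pow one n ≈ one
pow-one zero    = ≈-refl
pow-one (suc n) = ≈-trans (⊛ˡ one (pow-one n)) (Ring.*-identityˡ one)

pow-⊛ : ∀ a b n → pow (a ⊛ b) n ≈ pow a n ⊛ pow b n
pow-⊛ a b zero    = ≈-sym (Ring.*-identityˡ one)
pow-⊛ a b (suc n) = ≈-trans (⊛ˡ (a ⊛ b) (pow-⊛ a b n))
  (solve 4 (λ a b c d → (a :* b) :* (c :* d) := (a :* c) :* (b :* d)) ≈-refl a b (pow a n) (pow b n))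

pow-* : ∀ a m n → pow a (n ℕ.* m) ≈ pow (pow a m) n
pow-* a m zero    = ≈-refl
pow-* a m (suc n) = ≈-trans (pow-+ a m (n ℕ.* m)) (⊛ˡ (pow a m) (pow-* a m n))

pow-inverse : ∀ a b n → a ⊛ b ≈ one → pow a n ⊛ pow b n ≈ one
pow-inverse a b n e = ≈-trans (≈-sym (pow-⊛ a b n)) (≈-trans (pow-cong n e) (pow-one n))

cancel : ∀ u v → u ⊛ v ≈ one → ∀ a b → a ⊛ u ≈ b ⊛ u → a ≈ b
cancel u v e a b h = ≈-trans (expand a) (≈-trans (⊛ʳ h v) (≈-sym (expand b)))
  where
  expand : ∀ x → x ≈ (x ⊛ u) ⊛ v
  expand x = ≈-trans (≈-sym (Ring.*-identityʳ x)) (≈-trans (⊛ˡ x (≈-sym e)) (≈-sym (Ring.*-assoc x u v)))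

pow-q-double : ∀ j → pow q (j ℕ.* 2) ≈ pow q j ⊛ pow q j
pow-q-double j = ≈-trans (pow-≡ q (lemma j)) (pow-+ q j j)
  where
  lemma : ∀ j → j ℕ.* 2 ≡ j ℕ.+ j
  lemma = ℕ-Solver.solve-∀

σ₂-pow-q-double : ∀ j → σ₂ (pow q j) ≈ pow q (j ℕ.* 2)
σ₂-pow-q-double j = ≈-trans (σ₂-pow-q j) (≈-sym (pow-q-double j))

ν-pow-q-even : ∀ j → ν (pow q (j ℕ.* 2)) ≈ pow q (j ℕ.* 2)
ν-pow-q-even j = ≈-trans (Subν.S-cong (≈-sym (σ₂-pow-q-double j))) (≈-trans (ν-σ₂ (pow q j)) (σ₂-pow-q-double j))

ν-pow-q-odd : ∀ j → ν (pow q (suc (j ℕ.* 2))) ≈ ⊝ pow q (suc (j ℕ.* 2))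
ν-pow-q-odd j = ≈-trans (Subν.S-q⊛ (pow q (j ℕ.* 2))) (≈-trans (⊛ˡ q (⊛ˡ (C (- + 1)) (ν-pow-q-even j)))
  (solve 2 (λ q x → q :* (con (- + 1) :* x) := :- (q :* x)) ≈-refl q (pow q (j ℕ.* 2))))

-- Replacing `q` by `-q` fixes the factors of even exponent and turns `1 - q^m` into `1 + q^m` for
-- odd `m`. The finite version has `2N` factors, so that each induction step adds one odd and one
-- even exponent.
f₁-ν-f₁ : f 1 ⊛ (ν (f 1) ⊛ f 4) ≈ pow (f 2) 3
f₁-ν-f₁ = untruncate λ N → weaken (ℕₚ.n≤1+n N) (limiting N)
  where
  finite : ∀ N → poch 0 (N ℕ.* 2) ⊛ (ν (poch 0 (N ℕ.* 2)) ⊛ σ₂ (σ₂ (poch 0 N)))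
               ≈ σ₂ (poch 0 N) ⊛ (σ₂ (poch 0 N) ⊛ σ₂ (poch 0 (N ℕ.* 2)))
  finite zero    = ⊛-cong (≈-sym Sub₂.S-one) (⊛-cong (≈-trans Subν.S-one (≈-sym Sub₂.S-one)) (Sub₂.S-cong Sub₂.S-one))
  finite (suc N) = begin
    ((one ⊕ ⊝ y) ⊛ ((one ⊕ ⊝ x) ⊛ p)) ⊛ (ν ((one ⊕ ⊝ y) ⊛ ((one ⊕ ⊝ x) ⊛ p)) ⊛ σ₂ (σ₂ (poch 0 (suc N))))
      ≈⟨ ⊛ˡ ((one ⊕ ⊝ y) ⊛ ((one ⊕ ⊝ x) ⊛ p)) (⊛-cong ν-step (≈-trans (Sub₂.S-cong σ₂-step) σ₄-step)) ⟩
    ((one ⊕ ⊝ y) ⊛ ((one ⊕ ⊝ x) ⊛ p)) ⊛ (((one ⊕ ⊝ y) ⊛ ((one ⊕ x) ⊛ ν p)) ⊛ ((one ⊕ ⊝ (y ⊛ y)) ⊛ σ₂ (σ₂ (poch 0 N))))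
      ≈⟨ solve 5 (λ x y p n s →
           ((x :^ 0 :+ :- y) :* ((x :^ 0 :+ :- x) :* p)) :*
             (((x :^ 0 :+ :- y) :* ((x :^ 0 :+ x) :* n)) :* ((x :^ 0 :+ :- (y :* y)) :* s)) :=
           ((x :^ 0 :+ :- y) :* ((x :^ 0 :+ :- y) :* ((x :^ 0 :+ :- (y :* y)) :* (x :^ 0 :+ :- (x :* x))))) :*
             (p :* (n :* s))) ≈-refl x y p (ν p) (σ₂ (σ₂ (poch 0 N))) ⟩
    ((one ⊕ ⊝ y) ⊛ ((one ⊕ ⊝ y) ⊛ ((one ⊕ ⊝ (y ⊛ y)) ⊛ (one ⊕ ⊝ (x ⊛ x))))) ⊛ (p ⊛ (ν p ⊛ σ₂ (σ₂ (poch 0 N))))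
      ≈⟨ ⊛ˡ ((one ⊕ ⊝ y) ⊛ ((one ⊕ ⊝ y) ⊛ ((one ⊕ ⊝ (y ⊛ y)) ⊛ (one ⊕ ⊝ (x ⊛ x))))) (finite N) ⟩
    ((one ⊕ ⊝ y) ⊛ ((one ⊕ ⊝ y) ⊛ ((one ⊕ ⊝ (y ⊛ y)) ⊛ (one ⊕ ⊝ (x ⊛ x))))) ⊛ (s ⊛ (s ⊛ σ₂ p))
      ≈⟨ solve 5 (λ y₁ y₂ x₂ s p →
           (y₁ :* (y₁ :* (y₂ :* x₂))) :* (s :* (s :* p)) :=
           (y₁ :* s) :* ((y₁ :* s) :* (y₂ :* (x₂ :* p)))) ≈-refl
           (one ⊕ ⊝ y) (one ⊕ ⊝ (y ⊛ y)) (one ⊕ ⊝ (x ⊛ x)) s (σ₂ p) ⟩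
    ((one ⊕ ⊝ y) ⊛ s) ⊛ (((one ⊕ ⊝ y) ⊛ s) ⊛ ((one ⊕ ⊝ (y ⊛ y)) ⊛ ((one ⊕ ⊝ (x ⊛ x)) ⊛ σ₂ p)))
      ≈⟨ ⊛-cong σ₂-step (⊛-cong σ₂-step (≈-trans (Sub₂.S-⊛ (one ⊕ ⊝ y) ((one ⊕ ⊝ x) ⊛ p)) (⊛-cong (σ₂-1-q (suc (suc (N ℕ.* 2))))
           (≈-trans (Sub₂.S-⊛ (one ⊕ ⊝ x) p) (⊛ʳ (σ₂-1-q (suc (N ℕ.* 2))) (σ₂ p)))))) ⟨
    σ₂ (poch 0 (suc N)) ⊛ (σ₂ (poch 0 (suc N)) ⊛ σ₂ ((one ⊕ ⊝ y) ⊛ ((one ⊕ ⊝ x) ⊛ p))) ∎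
    where
    open ≈-Reasoning
    x = pow q (suc (N ℕ.* 2))
    y = pow q (suc N ℕ.* 2)
    p = poch 0 (N ℕ.* 2)
    s = σ₂ (poch 0 N)
    ν-step : ν ((one ⊕ ⊝ y) ⊛ ((one ⊕ ⊝ x) ⊛ p)) ≈ (one ⊕ ⊝ y) ⊛ ((one ⊕ x) ⊛ ν p)
    ν-step = ≈-trans (Subν.S-⊛ (one ⊕ ⊝ y) ((one ⊕ ⊝ x) ⊛ p)) (⊛-cong
      (≈-trans (Subν.S-⊕ one (⊝ y)) (⊕-cong Subν.S-one (≈-trans (Subν.S-⊝ y) (⊝-cong (ν-pow-q-even (suc N))))))
      (≈-trans (Subν.S-⊛ (one ⊕ ⊝ x) p) (⊛ʳ (≈-trans (Subν.S-⊕ one (⊝ x)) (⊕-cong Subν.S-one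
        (≈-trans (Subν.S-⊝ x) (≈-trans (⊝-cong (ν-pow-q-odd N)) (solve 1 (λ x → :- (:- x) := x) ≈-refl x))))) (ν p))))
    σ₂-step : σ₂ (poch 0 (suc N)) ≈ (one ⊕ ⊝ y) ⊛ s
    σ₂-step = ≈-trans (Sub₂.S-⊛ (one ⊕ ⊝ pow q (suc N)) (poch 0 N))
      (⊛ʳ (≈-trans (σ₂-1-q (suc N)) (⊕ˡ one (⊝-cong (≈-sym (pow-q-double (suc N)))))) s)
    σ₄-step : σ₂ ((one ⊕ ⊝ y) ⊛ s) ≈ (one ⊕ ⊝ (y ⊛ y)) ⊛ σ₂ s
    σ₄-step = ≈-trans (Sub₂.S-⊛ (one ⊕ ⊝ y) s) (⊛ʳ (σ₂-1-q (suc N ℕ.* 2)) (σ₂ s))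
  limiting : ∀ N → f 1 ⊛ (ν (f 1) ⊛ f 4) ≈[ suc N ] pow (f 2) 3
  limiting N = begin
    f 1 ⊛ (ν (f 1) ⊛ f 4)
      ≈⟨ truncate (suc N) (⊛ˡ (f 1) (⊛ˡ (ν (f 1)) (≈-trans (Sub₂.S-cong (σ₂-f 0)) (σ₂-f 1)))) ⟨
    f 1 ⊛ (ν (f 1) ⊛ σ₂ (σ₂ (f 1)))
      ≈⟨ M.⊛-cong f₁≈ (M.⊛-cong (Subν.S-cong< (suc N) f₁≈) (Sub₂.S-cong< (suc N) (Sub₂.S-cong< (suc N) (f₁-limit N)))) ⟩
    p₂ ⊛ (ν p₂ ⊛ σ₂ (σ₂ p))
      ≈⟨ truncate (suc N) (finite N) ⟩
    σ₂ p ⊛ (σ₂ p ⊛ σ₂ p₂)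
      ≈⟨ M.⊛-cong (Sub₂.S-cong< (suc N) (f₁-limit N)) (M.⊛-cong (Sub₂.S-cong< (suc N) (f₁-limit N)) (Sub₂.S-cong< (suc N) f₁≈)) ⟨
    σ₂ (f 1) ⊛ (σ₂ (f 1) ⊛ σ₂ (f 1))
      ≈⟨ truncate (suc N) (⊛-cong (σ₂-f 0) (⊛-cong (σ₂-f 0) (σ₂-f 0))) ⟩
    f 2 ⊛ (f 2 ⊛ f 2)
      ≈⟨ truncate (suc N) (solve 1 (λ x → x :* (x :* x) := x :^ 3) ≈-refl (f 2)) ⟩
    pow (f 2) 3 ∎
    where
    module M = Mod₅< (suc N)
    open M.≈-Reasoning
    p = poch 0 N
    p₂ = poch 0 (N ℕ.* 2)
    f₁≈ : f 1 ≈[ suc N ] p₂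
    f₁≈ = weaken (s≤s (ℕₚ.m≤m*n N 2)) (f₁-limit (N ℕ.* 2))

-- Dissection of theta series by the parity of the square

triangular : ℕ → ℕ
triangular zero    = 0
triangular (suc n) = suc n ℕ.+ triangular n

odd-square : ∀ n → suc (n ℕ.* 2) ℕ.* suc (n ℕ.* 2) ≡ suc (triangular n ℕ.* 2 ℕ.* 2 ℕ.* 2)
odd-square zero    = refl
odd-square (suc n) = trans (step n) (trans (cong (ℕ._+ 8 ℕ.* suc n) (odd-square n)) (collect n (triangular n)))
  where
  step : ∀ n → suc (suc n ℕ.* 2) ℕ.* suc (suc n ℕ.* 2) ≡ suc (n ℕ.* 2) ℕ.* suc (n ℕ.* 2) ℕ.+ 8 ℕ.* suc n
  step = ℕ-Solver.solve-∀
  collect : ∀ n t → suc (t ℕ.* 2 ℕ.* 2 ℕ.* 2) ℕ.+ 8 ℕ.* suc n ≡ suc ((suc n ℕ.+ t) ℕ.* 2 ℕ.* 2 ℕ.* 2)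
  collect = ℕ-Solver.solve-∀

even-square : ∀ n → (n ℕ.* 2) ℕ.* (n ℕ.* 2) ≡ n ℕ.* n ℕ.* 2 ℕ.* 2
even-square = ℕ-Solver.solve-∀

Ψ : ℕ → Series
Ψ zero    = one
Ψ (suc n) = Ψ n ⊕ pow q (triangular (suc n))

ψ : Series
ψ = limit Ψ

ψ-limit : ∀ N → ψ ≈[ suc N ] Ψ N
ψ-limit = limit≈ Ψ λ N → let module M = Mod₅< (suc N) in M.≈-trans
  (M.⊕ˡ (Ψ N) (pow-q-zero (ℕₚ.m≤m+n (suc N) (triangular N))))
  (truncate (suc N) (Ring.+-identityʳ (Ψ N)))

-- Even and odd squares are 4s² and 1 + 8 s(s+1)/2.
φ-dissection : ∀ ε → ε ⊛ ε ≈ one →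
  φ ε ≈ σ₂ (σ₂ (φ (C (+ 1)))) ⊕ ε ⊛ (q ⊛ σ₂ (σ₂ (σ₂ (C (+ 2) ⊛ ψ))))
φ-dissection ε e² = untruncate λ N → weaken (ℕₚ.n≤1+n N) (limiting N)
  where
  pow-even : ∀ n → pow ε (n ℕ.* 2) ≈ one
  pow-even zero    = ≈-refl
  pow-even (suc n) = ≈-trans (⊛ˡ ε (⊛ˡ ε (pow-even n)))
    (≈-trans (solve 2 (λ e o → e :* (e :* o) := (e :* e) :* o) ≈-refl ε one)
    (≈-trans (⊛ʳ e² one) (Ring.*-identityˡ one)))
  C1-pow : ∀ n → pow (C (+ 1)) n ≈ one
  C1-pow n = ≈-trans (pow-cong n (≈-sym one≈C1)) (pow-one n)

  σ₈ : Series → Series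
  σ₈ a = σ₂ (σ₂ (σ₂ a))
  T : ℕ → Series
  T N = σ₂ (σ₂ (Θ (C (+ 1)) N)) ⊕ ε ⊛ (q ⊛ σ₈ (C (+ 2) ⊛ Ψ N))

  σ₈-C2 : ∀ a → σ₈ (C (+ 2) ⊛ a) ≈ C (+ 2) ⊛ σ₈ a
  σ₈-C2 a = ≈-trans (Sub₂.S-cong (≈-trans (Sub₂.S-cong (Sub₂.S-C⊛ (+ 2) a)) (Sub₂.S-C⊛ (+ 2) (σ₂ a)))) (Sub₂.S-C⊛ (+ 2) (σ₂ (σ₂ a)))

  even-term : ∀ n → σ₂ (σ₂ (C (+ 2) ⊛ (pow (C (+ 1)) n ⊛ pow q (n ℕ.* n)))) ≈
    C (+ 2) ⊛ (pow ε (n ℕ.* 2) ⊛ pow q (n ℕ.* 2 ℕ.* (n ℕ.* 2)))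
  even-term n = begin
    σ₂ (σ₂ (C (+ 2) ⊛ (pow (C (+ 1)) n ⊛ pow q (n ℕ.* n))))
      ≈⟨ Sub₂.S-cong (Sub₂.S-cong (⊛ˡ (C (+ 2)) (≈-trans (⊛ʳ (C1-pow n) (pow q (n ℕ.* n))) (Ring.*-identityˡ (pow q (n ℕ.* n)))))) ⟩
    σ₂ (σ₂ (C (+ 2) ⊛ pow q (n ℕ.* n)))
      ≈⟨ ≈-trans (Sub₂.S-cong (Sub₂.S-C⊛ (+ 2) (pow q (n ℕ.* n)))) (Sub₂.S-C⊛ (+ 2) (σ₂ (pow q (n ℕ.* n)))) ⟩
    C (+ 2) ⊛ σ₂ (σ₂ (pow q (n ℕ.* n)))
      ≈⟨ ⊛ˡ (C (+ 2)) (≈-trans (Sub₂.S-cong (σ₂-pow-q-double (n ℕ.* n))) (σ₂-pow-q-double (n ℕ.* n ℕ.* 2))) ⟩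
    C (+ 2) ⊛ pow q (n ℕ.* n ℕ.* 2 ℕ.* 2)
      ≈⟨ ⊛ˡ (C (+ 2)) (pow-≡ q (even-square n)) ⟨
    C (+ 2) ⊛ pow q (n ℕ.* 2 ℕ.* (n ℕ.* 2))
      ≈⟨ ⊛ˡ (C (+ 2)) (≈-trans (⊛ʳ (pow-even n) (pow q (n ℕ.* 2 ℕ.* (n ℕ.* 2)))) (Ring.*-identityˡ (pow q (n ℕ.* 2 ℕ.* (n ℕ.* 2))))) ⟨
    C (+ 2) ⊛ (pow ε (n ℕ.* 2) ⊛ pow q (n ℕ.* 2 ℕ.* (n ℕ.* 2))) ∎
    where open ≈-Reasoning

  odd-term : ∀ n → ε ⊛ (q ⊛ σ₈ (C (+ 2) ⊛ pow q (triangular n))) ≈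
    C (+ 2) ⊛ (pow ε (suc (n ℕ.* 2)) ⊛ pow q (suc (n ℕ.* 2) ℕ.* suc (n ℕ.* 2)))
  odd-term n = begin
    ε ⊛ (q ⊛ σ₈ (C (+ 2) ⊛ pow q t))
      ≈⟨ ⊛ˡ ε (⊛ˡ q (≈-trans (σ₈-C2 (pow q t)) (⊛ˡ (C (+ 2)) (≈-trans (Sub₂.S-cong (≈-trans (Sub₂.S-cong
           (σ₂-pow-q-double t)) (σ₂-pow-q-double (t ℕ.* 2)))) (σ₂-pow-q-double (t ℕ.* 2 ℕ.* 2)))))) ⟩
    ε ⊛ (q ⊛ (C (+ 2) ⊛ pow q (t ℕ.* 2 ℕ.* 2 ℕ.* 2)))
      ≈⟨ solve 4 (λ e q d x → e :* (q :* (d :* x)) := d :* ((e :* q :^ 0) :* (q :* x))) ≈-refl ε q (C (+ 2)) (pow q (t ℕ.* 2 ℕ.* 2 ℕ.* 2)) ⟩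
    C (+ 2) ⊛ ((ε ⊛ one) ⊛ pow q (suc (t ℕ.* 2 ℕ.* 2 ℕ.* 2)))
      ≈⟨ ⊛ˡ (C (+ 2)) (⊛-cong (⊛ˡ ε (pow-even n)) (pow-≡ q (odd-square n))) ⟨
    C (+ 2) ⊛ (pow ε (suc (n ℕ.* 2)) ⊛ pow q (suc (n ℕ.* 2) ℕ.* suc (n ℕ.* 2))) ∎
    where
    open ≈-Reasoning
    t = triangular n

  σ₈-⊕ : ∀ a b → σ₈ (C (+ 2) ⊛ (a ⊕ b)) ≈ σ₈ (C (+ 2) ⊛ a) ⊕ σ₈ (C (+ 2) ⊛ b)
  σ₈-⊕ a b = ≈-trans (Sub₂.S-cong (≈-trans (Sub₂.S-cong (≈-trans (Sub₂.S-cong (Ring.distribˡ (C (+ 2)) a b))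
    (Sub₂.S-⊕ (C (+ 2) ⊛ a) (C (+ 2) ⊛ b)))) (Sub₂.S-⊕ (σ₂ (C (+ 2) ⊛ a)) (σ₂ (C (+ 2) ⊛ b)))))
    (Sub₂.S-⊕ (σ₂ (σ₂ (C (+ 2) ⊛ a))) (σ₂ (σ₂ (C (+ 2) ⊛ b))))

  -- Cut at the odd index `2N + 1`, the sum has `N` positive even squares and `N + 1` odd ones, as
  -- many as `Θ` and `Ψ` have terms at stage `N`.
  finite : ∀ N → Θ ε (suc (N ℕ.* 2)) ≈ T N
  finite zero    = ⊕-cong (≈-sym (≈-trans (Sub₂.S-cong Sub₂.S-one) Sub₂.S-one)) (≈-sym (odd-term 0))
  finite (suc N) = begin
    (Θ ε (suc (N ℕ.* 2)) ⊕ C (+ 2) ⊛ (pow ε (suc N ℕ.* 2) ⊛ pow q (suc N ℕ.* 2 ℕ.* (suc N ℕ.* 2))))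
      ⊕ C (+ 2) ⊛ (pow ε (suc (suc N ℕ.* 2)) ⊛ pow q (suc (suc N ℕ.* 2) ℕ.* suc (suc N ℕ.* 2)))
      ≈⟨ ⊕-cong (⊕-cong (finite N) (≈-sym (even-term (suc N)))) (≈-sym (odd-term (suc N))) ⟩
    (T N ⊕ σ₂ (σ₂ u)) ⊕ ε ⊛ (q ⊛ σ₈ (C (+ 2) ⊛ v))
      ≈⟨ solve 6 (λ a b c d e q → ((a :+ e :* (q :* b)) :+ c) :+ e :* (q :* d) := (a :+ c) :+ e :* (q :* (b :+ d))) ≈-refl
           (σ₂ (σ₂ (Θ (C (+ 1)) N))) (σ₈ (C (+ 2) ⊛ Ψ N)) (σ₂ (σ₂ u)) (σ₈ (C (+ 2) ⊛ v)) ε q ⟩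
    (σ₂ (σ₂ (Θ (C (+ 1)) N)) ⊕ σ₂ (σ₂ u)) ⊕ ε ⊛ (q ⊛ (σ₈ (C (+ 2) ⊛ Ψ N) ⊕ σ₈ (C (+ 2) ⊛ v)))
      ≈⟨ ⊕-cong (≈-trans (Sub₂.S-cong (Sub₂.S-⊕ (Θ (C (+ 1)) N) u)) (Sub₂.S-⊕ (σ₂ (Θ (C (+ 1)) N)) (σ₂ u)))
           (⊛ˡ ε (⊛ˡ q (σ₈-⊕ (Ψ N) v))) ⟨
    T (suc N) ∎
    where
    open ≈-Reasoning
    u = C (+ 2) ⊛ (pow (C (+ 1)) (suc N) ⊛ pow q (suc N ℕ.* suc N))
    v = pow q (triangular (suc N))

  limiting : ∀ N → φ ε ≈[ suc N ] σ₂ (σ₂ (φ (C (+ 1)))) ⊕ ε ⊛ (q ⊛ σ₈ (C (+ 2) ⊛ ψ))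
  limiting N = M.≈-trans (weaken (s≤s (ℕₚ.m≤n⇒m≤1+n (ℕₚ.m≤m*n N 2))) (φ-limit ε (suc (N ℕ.* 2))))
    (M.≈-trans (truncate (suc N) (finite N)) (M.≈-sym (M.⊕-cong
      (Sub₂.S-cong< (suc N) (Sub₂.S-cong< (suc N) (φ-limit (C (+ 1)) N)))
      (M.⊛ˡ ε (M.⊛ˡ q (Sub₂.S-cong< (suc N) (Sub₂.S-cong< (suc N) (Sub₂.S-cong< (suc N) (M.⊛ˡ (C (+ 2)) (ψ-limit N))))))))))
    where module M = Mod₅< (suc N)

-- Relations between theta series

σ₂-even : ∀ a n → σ₂ a (n ℕ.* 2) ≡ a n
σ₂-even a zero    = refl
σ₂-even a (suc n) = σ₂-even (tail a) n

σ₂-odd : ∀ a n → σ₂ a (suc (n ℕ.* 2)) ≡ + 0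
σ₂-odd a zero    = refl
σ₂-odd a (suc n) = σ₂-odd (tail a) n

σ₂-injective : ∀ a b → σ₂ a ≈ σ₂ b → a ≈ b
σ₂-injective a b e = at λ n _ → ~-trans (~-reflexive (sym (σ₂-even a n)))
  (~-trans (coeff e (n ℕ.* 2) _) (~-reflexive (σ₂-even b n)))

⊛-inverse : ∀ u v u′ v′ → u ⊛ v ≈ one → u′ ⊛ v′ ≈ one → (u ⊛ u′) ⊛ (v ⊛ v′) ≈ one
⊛-inverse u v u′ v′ e e′ = ≈-trans
  (solve 4 (λ a b c d → (a :* b) :* (c :* d) := (a :* c) :* (b :* d)) ≈-refl u u′ v v′)
  (≈-trans (⊛-cong e e′) (Ring.*-identityˡ one))

pow₄ : ∀ x {y} → x ⊛ x ≈ y → pow x 4 ≈ y ⊛ y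
pow₄ x e = ≈-trans (solve 1 (λ x → x :^ 4 := (x :* x) :* (x :* x)) ≈-refl x) (⊛-cong e e)

pow-scale₄ : ∀ a x y z → a ⊛ (pow x 2 ⊛ pow z 2) ≈ pow y 5 → pow a 4 ⊛ (pow x 8 ⊛ pow z 8) ≈ pow y 20
pow-scale₄ a x y z e = begin
  pow a 4 ⊛ (pow x 8 ⊛ pow z 8)
    ≈⟨ ⊛ˡ (pow a 4) (⊛-cong (pow-* x 2 4) (pow-* z 2 4)) ⟩
  pow a 4 ⊛ (pow (pow x 2) 4 ⊛ pow (pow z 2) 4)
    ≈⟨ ≈-trans (pow-⊛ a (pow x 2 ⊛ pow z 2) 4) (⊛ˡ (pow a 4) (pow-⊛ (pow x 2) (pow z 2) 4)) ⟨
  pow (a ⊛ (pow x 2 ⊛ pow z 2)) 4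
    ≈⟨ pow-cong 4 e ⟩
  pow (pow y 5) 4
    ≈⟨ pow-* y 5 4 ⟨
  pow y 20 ∎
  where open ≈-Reasoning

module ThetaQuotient (a x y z v : Series) (inverse : y ⊛ v ≈ one)
  (product : a ⊛ (pow x 2 ⊛ pow z 2) ≈ pow y 5) (double : σ₂ x ≈ y) (double′ : σ₂ y ≈ z) where
  open ≈-Reasoning

  -- The series `q f₄⁸/f₂⁴ = q ψ(q²)⁴`, with the factor 16 of Jacobi's identity reduced to 1.
  E : Series
  E = q ⊛ (pow z 8 ⊛ pow v 4)

  E-denominator : E ⊛ pow y 4 ≈ q ⊛ pow z 8
  E-denominator = begin
    (q ⊛ (pow z 8 ⊛ pow v 4)) ⊛ pow y 4
      ≈⟨ solve 4 (λ q z y v → (q :* (z :* v)) :* y := (q :* z) :* (y :* v)) ≈-refl q (pow z 8) (pow y 4) (pow v 4) ⟩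
    (q ⊛ pow z 8) ⊛ (pow y 4 ⊛ pow v 4)
      ≈⟨ ⊛ˡ (q ⊛ pow z 8) (pow-inverse y v 4 inverse) ⟩
    (q ⊛ pow z 8) ⊛ one
      ≈⟨ Ring.*-identityʳ (q ⊛ pow z 8) ⟩
    q ⊛ pow z 8 ∎

  a⁴-E : (pow a 4 ⊛ pow x 8) ⊛ E ≈ q ⊛ pow y 16
  a⁴-E = begin
    (pow a 4 ⊛ pow x 8) ⊛ (q ⊛ (pow z 8 ⊛ pow v 4))
      ≈⟨ solve 5 (λ a x z q v → (a :* x) :* (q :* (z :* v)) := (a :* (x :* z)) :* (q :* v)) ≈-refl
           (pow a 4) (pow x 8) (pow z 8) q (pow v 4) ⟩
    (pow a 4 ⊛ (pow x 8 ⊛ pow z 8)) ⊛ (q ⊛ pow v 4)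
      ≈⟨ ⊛ʳ (≈-trans (pow-scale₄ a x y z product) (pow-+ y 16 4)) (q ⊛ pow v 4) ⟩
    (pow y 16 ⊛ pow y 4) ⊛ (q ⊛ pow v 4)
      ≈⟨ solve 4 (λ s t q v → (s :* t) :* (q :* v) := (q :* s) :* (t :* v)) ≈-refl (pow y 16) (pow y 4) q (pow v 4) ⟩
    (q ⊛ pow y 16) ⊛ (pow y 4 ⊛ pow v 4)
      ≈⟨ ⊛ˡ (q ⊛ pow y 16) (pow-inverse y v 4 inverse) ⟩
    (q ⊛ pow y 16) ⊛ one
      ≈⟨ Ring.*-identityʳ (q ⊛ pow y 16) ⟩
    q ⊛ pow y 16 ∎

  A⁴-E : (pow (σ₂ a) 4 ⊛ pow y 8) ⊛ σ₂ E ≈ (q ⊛ q) ⊛ pow z 16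
  A⁴-E = begin
    (pow (σ₂ a) 4 ⊛ pow y 8) ⊛ σ₂ E
      ≈⟨ ⊛ʳ (⊛-cong (Sub₂.S-pow a 4) (≈-trans (Sub₂.S-pow x 8) (pow-cong 8 double))) (σ₂ E) ⟨
    (σ₂ (pow a 4) ⊛ σ₂ (pow x 8)) ⊛ σ₂ E
      ≈⟨ ⊛ʳ (Sub₂.S-⊛ (pow a 4) (pow x 8)) (σ₂ E) ⟨
    σ₂ (pow a 4 ⊛ pow x 8) ⊛ σ₂ E
      ≈⟨ Sub₂.S-⊛ (pow a 4 ⊛ pow x 8) E ⟨
    σ₂ ((pow a 4 ⊛ pow x 8) ⊛ E)
      ≈⟨ Sub₂.S-cong a⁴-E ⟩
    σ₂ (q ⊛ pow y 16)
      ≈⟨ Sub₂.S-⊛ q (pow y 16) ⟩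
    σ₂ q ⊛ σ₂ (pow y 16)
      ≈⟨ ⊛-cong (≈-trans Sub₂.S-q (solve 1 (λ q → q :* q :^ 1 := q :* q) ≈-refl q))
           (≈-trans (Sub₂.S-pow y 16) (pow-cong 16 double′)) ⟩
    (q ⊛ q) ⊛ pow z 16 ∎

  -- The product side of the equation that `D-square` gives for the theta side. By the product for
  -- `a`, `a⁴ f₁⁸ E = q f₂¹⁶`; under `q ↦ q²` the right side becomes `q² f₄¹⁶`, which is `(E f₂⁴)²`.
  E-square : E ⊛ E ≈ pow (σ₂ a) 4 ⊛ σ₂ E
  E-square = cancel (pow y 8) (pow v 8) (pow-inverse y v 8 inverse) (E ⊛ E) (pow (σ₂ a) 4 ⊛ σ₂ E) (begin
    (E ⊛ E) ⊛ pow y 8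
      ≈⟨ ⊛ˡ (E ⊛ E) (pow-+ y 4 4) ⟩
    (E ⊛ E) ⊛ (pow y 4 ⊛ pow y 4)
      ≈⟨ solve 2 (λ e y → (e :* e) :* (y :* y) := (e :* y) :* (e :* y)) ≈-refl E (pow y 4) ⟩
    (E ⊛ pow y 4) ⊛ (E ⊛ pow y 4)
      ≈⟨ ⊛-cong E-denominator E-denominator ⟩
    (q ⊛ pow z 8) ⊛ (q ⊛ pow z 8)
      ≈⟨ solve 2 (λ q z → (q :* z) :* (q :* z) := (q :* q) :* (z :* z)) ≈-refl q (pow z 8) ⟩
    (q ⊛ q) ⊛ (pow z 8 ⊛ pow z 8)
      ≈⟨ ⊛ˡ (q ⊛ q) (pow-+ z 8 8) ⟨
    (q ⊛ q) ⊛ pow z 16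
      ≈⟨ A⁴-E ⟨
    (pow (σ₂ a) 4 ⊛ pow y 8) ⊛ σ₂ E
      ≈⟨ solve 3 (λ a y e → (a :* y) :* e := (a :* e) :* y) ≈-refl (pow (σ₂ a) 4) (pow y 8) (σ₂ E) ⟩
    (pow (σ₂ a) 4 ⊛ σ₂ E) ⊛ pow y 8 ∎)

difference-zero : ∀ {x y} → x ⊕ ⊝ y ≈ C (+ 0) → x ≈ y
difference-zero {x} {y} e = ≈-trans (solve 2 (λ x y → x := (x :+ :- y) :+ y) ≈-refl x y)
  (≈-trans (⊕ʳ e y) (Ring.+-identityˡ y))

ν-q⊛σ₂ : ∀ x → ν (q ⊛ σ₂ x) ≈ ⊝ (q ⊛ σ₂ x)
ν-q⊛σ₂ x = ≈-trans (Subν.S-q⊛ (σ₂ x)) (≈-trans (⊛ˡ q (⊛ˡ (C (- + 1)) (ν-σ₂ x)))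
  (solve 2 (λ q y → q :* (con (- + 1) :* y) := :- (q :* y)) ≈-refl q (σ₂ x)))

ν-f₂ : ν (f 2) ≈ f 2
ν-f₂ = ≈-trans (Subν.S-cong (≈-sym (σ₂-f 0))) (≈-trans (ν-σ₂ (f 1)) (σ₂-f 0))

module Theta where

  -- φ(q) and φ(-q)
  a b : Series
  a = φ (C (+ 1))
  b = φ (C (- + 1))

  A B : Series
  A = σ₂ a
  B = σ₂ b

  -- The series `2 ψ(q²)`. The odd part of `a` is `q κ(q⁴)` and that of `a²` is `q κ(q²)²`.
  κ : Series
  κ = σ₂ (C (+ 2) ⊛ ψ)

  a-dissection : a ≈ σ₂ A ⊕ q ⊛ σ₂ (σ₂ κ)
  a-dissection = ≈-trans (φ-dissection (C (+ 1)) (≈-trans (⊛-cong (≈-sym one≈C1) (≈-sym one≈C1)) (Ring.*-identityˡ one)))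
    (solve 3 (λ x q y → x :+ con (+ 1) :* (q :* y) := x :+ q :* y) ≈-refl (σ₂ A) q (σ₂ (σ₂ κ)))

  b-dissection : b ≈ σ₂ A ⊕ ⊝ (q ⊛ σ₂ (σ₂ κ))
  b-dissection = ≈-trans (φ-dissection (C (- + 1)) (≈-trans (solve 0 (con (- + 1) :* con (- + 1) := con (+ 1)) ≈-refl) (≈-sym one≈C1)))
    (solve 3 (λ x q y → x :+ con (- + 1) :* (q :* y) := x :+ :- (q :* y)) ≈-refl (σ₂ A) q (σ₂ (σ₂ κ)))

  ν-b : ν b ≈ a
  ν-b = begin
    ν b                                            ≈⟨ Subν.S-cong b-dissection ⟩
    ν (σ₂ A ⊕ ⊝ (q ⊛ σ₂ (σ₂ κ)))                   ≈⟨ Subν.S-⊕ (σ₂ A) (⊝ (q ⊛ σ₂ (σ₂ κ))) ⟩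
    ν (σ₂ A) ⊕ ν (⊝ (q ⊛ σ₂ (σ₂ κ)))               ≈⟨ ⊕-cong (ν-σ₂ A) (≈-trans (Subν.S-⊝ (q ⊛ σ₂ (σ₂ κ))) (⊝-cong (ν-q⊛σ₂ (σ₂ κ)))) ⟩
    σ₂ A ⊕ ⊝ (⊝ (q ⊛ σ₂ (σ₂ κ)))                   ≈⟨ solve 2 (λ x y → x :+ :- (:- y) := x :+ y) ≈-refl (σ₂ A) (q ⊛ σ₂ (σ₂ κ)) ⟩
    σ₂ A ⊕ q ⊛ σ₂ (σ₂ κ)                           ≈⟨ a-dissection ⟨
    a                                              ∎
    where open ≈-Reasoning

  a-f₂ : a ⊛ f 2 ≈ ν (f 1) ⊛ ν (f 1)
  a-f₂ = ≈-trans (⊛-cong (≈-sym ν-b) (≈-sym ν-f₂)) (≈-trans (≈-sym (Subν.S-⊛ b (f 2)))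
    (≈-trans (Subν.S-cong gauss) (Subν.S-⊛ (f 1) (f 1))))

  B-f₄ : B ⊛ f 4 ≈ f 2 ⊛ f 2
  B-f₄ = ≈-trans (⊛ˡ B (≈-sym (σ₂-f 1))) (≈-trans (≈-sym (Sub₂.S-⊛ b (f 2)))
    (≈-trans (Sub₂.S-cong gauss) (≈-trans (Sub₂.S-⊛ (f 1) (f 1)) (⊛-cong (σ₂-f 0) (σ₂-f 0)))))

  -- After multiplication by `(f₂ f₄)²` both sides are `f₂⁶`: the left by Gauss's identity at `q²`,
  -- the right by Gauss's identity at `q` and `-q` together with `f₁-ν-f₁`.
  B² : B ⊛ B ≈ a ⊛ b
  B² = cancel ((y ⊛ z) ⊛ (y ⊛ z)) ((y′ ⊛ z′) ⊛ (y′ ⊛ z′)) (⊛-inverse (y ⊛ z) (y′ ⊛ z′) (y ⊛ z) (y′ ⊛ z′) yz yz) (B ⊛ B) (a ⊛ b) (begin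
    (B ⊛ B) ⊛ ((y ⊛ z) ⊛ (y ⊛ z))      ≈⟨ solve 3 (λ B y z → (B :* B) :* ((y :* z) :* (y :* z)) := (B :* z) :* ((B :* z) :* (y :* y))) ≈-refl B y z ⟩
    (B ⊛ z) ⊛ ((B ⊛ z) ⊛ (y ⊛ y))      ≈⟨ ⊛-cong B-f₄ (⊛ʳ B-f₄ (y ⊛ y)) ⟩
    (y ⊛ y) ⊛ ((y ⊛ y) ⊛ (y ⊛ y))      ≈⟨ solve 1 (λ y → (y :* y) :* ((y :* y) :* (y :* y)) := y :^ 3 :* y :^ 3) ≈-refl y ⟩
    pow y 3 ⊛ pow y 3                  ≈⟨ ⊛-cong f₁-ν-f₁ f₁-ν-f₁ ⟨
    (x ⊛ (ν x ⊛ z)) ⊛ (x ⊛ (ν x ⊛ z))  ≈⟨ solve 3 (λ x n z → (x :* (n :* z)) :* (x :* (n :* z)) := (n :* n) :* ((x :* x) :* (z :* z))) ≈-refl x (ν x) z ⟩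
    (ν x ⊛ ν x) ⊛ ((x ⊛ x) ⊛ (z ⊛ z))  ≈⟨ ⊛-cong a-f₂ (⊛ʳ gauss (z ⊛ z)) ⟨
    (a ⊛ y) ⊛ ((b ⊛ y) ⊛ (z ⊛ z))      ≈⟨ solve 4 (λ a b y z → (a :* y) :* ((b :* y) :* (z :* z)) := (a :* b) :* ((y :* z) :* (y :* z))) ≈-refl a b y z ⟩
    (a ⊛ b) ⊛ ((y ⊛ z) ⊛ (y ⊛ z))      ∎)
    where
    open ≈-Reasoning
    x = f 1
    y = f 2
    z = f 4
    y′ = fInv 2
    z′ = fInv 4
    yz : (y ⊛ z) ⊛ (y′ ⊛ z′) ≈ one
    yz = ⊛-inverse y y′ z z′ (f-fInv 1) (f-fInv 3)

  a-product : a ⊛ (pow (f 1) 2 ⊛ pow (f 4) 2) ≈ pow (f 2) 5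
  a-product = cancel (f 2) (fInv 2) (f-fInv 1) (a ⊛ (pow x 2 ⊛ pow z 2)) (pow y 5) (begin
    (a ⊛ (pow x 2 ⊛ pow z 2)) ⊛ y      ≈⟨ solve 4 (λ a x y z → (a :* (x :^ 2 :* z :^ 2)) :* y := (a :* y) :* (x :^ 2 :* z :^ 2)) ≈-refl a x y z ⟩
    (a ⊛ y) ⊛ (pow x 2 ⊛ pow z 2)      ≈⟨ ⊛ʳ a-f₂ (pow x 2 ⊛ pow z 2) ⟩
    (ν x ⊛ ν x) ⊛ (pow x 2 ⊛ pow z 2)  ≈⟨ solve 3 (λ n x z → (n :* n) :* (x :^ 2 :* z :^ 2) := (x :* (n :* z)) :* (x :* (n :* z))) ≈-refl (ν x) x z ⟩
    (x ⊛ (ν x ⊛ z)) ⊛ (x ⊛ (ν x ⊛ z))  ≈⟨ ⊛-cong f₁-ν-f₁ f₁-ν-f₁ ⟩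
    pow y 3 ⊛ pow y 3                  ≈⟨ solve 1 (λ y → y :^ 3 :* y :^ 3 := y :^ 5 :* y) ≈-refl y ⟩
    pow y 5 ⊛ y                        ∎)
    where
    open ≈-Reasoning
    x = f 1
    y = f 2
    z = f 4

  -- Squaring the dissection of `b` directly would not give this form. Instead `b(q²)² = ab` is a
  -- product of sum and difference of the same two parts, hence a difference of squares in `q²`, and
  -- `q² ↦ q` can be undone by injectivity of `σ₂`.
  b²-dissection : b ⊛ b ≈ A ⊛ A ⊕ ⊝ (q ⊛ σ₂ (κ ⊛ κ))
  b²-dissection = σ₂-injective (b ⊛ b) (A ⊛ A ⊕ ⊝ (q ⊛ σ₂ (κ ⊛ κ))) (begin
    σ₂ (b ⊛ b)                                     ≈⟨ Sub₂.S-⊛ b b ⟩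
    B ⊛ B                                          ≈⟨ B² ⟩
    a ⊛ b                                          ≈⟨ ⊛-cong a-dissection b-dissection ⟩
    (σ₂ A ⊕ q ⊛ k) ⊛ (σ₂ A ⊕ ⊝ (q ⊛ k))            ≈⟨ solve 3 (λ x q k → (x :+ q :* k) :* (x :+ :- (q :* k)) := x :* x :+ :- ((q :* q :^ 1) :* (k :* k))) ≈-refl (σ₂ A) q k ⟩
    σ₂ A ⊛ σ₂ A ⊕ ⊝ ((q ⊛ pow q 1) ⊛ (k ⊛ k))      ≈⟨ ⊕-cong (Sub₂.S-⊛ A A) (⊝-cong (⊛-cong Sub₂.S-q
                                                        (≈-trans (Sub₂.S-cong (Sub₂.S-⊛ κ κ)) (Sub₂.S-⊛ (σ₂ κ) (σ₂ κ))))) ⟨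
    σ₂ (A ⊛ A) ⊕ ⊝ (σ₂ q ⊛ σ₂ (σ₂ (κ ⊛ κ)))        ≈⟨ ⊕ˡ (σ₂ (A ⊛ A)) (⊝-cong (Sub₂.S-⊛ q (σ₂ (κ ⊛ κ)))) ⟨
    σ₂ (A ⊛ A) ⊕ ⊝ σ₂ (q ⊛ σ₂ (κ ⊛ κ))             ≈⟨ ⊕ˡ (σ₂ (A ⊛ A)) (Sub₂.S-⊝ (q ⊛ σ₂ (κ ⊛ κ))) ⟨
    σ₂ (A ⊛ A) ⊕ σ₂ (⊝ (q ⊛ σ₂ (κ ⊛ κ)))           ≈⟨ Sub₂.S-⊕ (A ⊛ A) (⊝ (q ⊛ σ₂ (κ ⊛ κ))) ⟨
    σ₂ (A ⊛ A ⊕ ⊝ (q ⊛ σ₂ (κ ⊛ κ)))                ∎)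
    where
    open ≈-Reasoning
    k = σ₂ (σ₂ κ)

  a²-dissection : a ⊛ a ≈ A ⊛ A ⊕ q ⊛ σ₂ (κ ⊛ κ)
  a²-dissection = begin
    a ⊛ a                                          ≈⟨ ⊛-cong ν-b ν-b ⟨
    ν b ⊛ ν b                                      ≈⟨ Subν.S-⊛ b b ⟨
    ν (b ⊛ b)                                      ≈⟨ Subν.S-cong b²-dissection ⟩
    ν (A ⊛ A ⊕ ⊝ (q ⊛ k))                          ≈⟨ Subν.S-⊕ (A ⊛ A) (⊝ (q ⊛ k)) ⟩
    ν (A ⊛ A) ⊕ ν (⊝ (q ⊛ k))                      ≈⟨ ⊕-cong (≈-trans (Subν.S-⊛ A A) (⊛-cong (ν-σ₂ a) (ν-σ₂ a)))
                                                        (≈-trans (Subν.S-⊝ (q ⊛ k)) (⊝-cong (ν-q⊛σ₂ (κ ⊛ κ)))) ⟩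
    A ⊛ A ⊕ ⊝ (⊝ (q ⊛ k))                          ≈⟨ solve 2 (λ x y → x :+ :- (:- y) := x :+ y) ≈-refl (A ⊛ A) (q ⊛ k) ⟩
    A ⊛ A ⊕ q ⊛ k                                  ∎
    where
    open ≈-Reasoning
    k = σ₂ (κ ⊛ κ)

  -- 3 is the inverse of 2.
  A² : A ⊛ A ≈ C (+ 3) ⊛ (a ⊛ a ⊕ b ⊛ b)
  A² = ≈-sym (≈-trans (⊛ˡ (C (+ 3)) (⊕-cong a²-dissection b²-dissection))
    (solve 2 (λ x y → con (+ 3) :* ((x :+ y) :+ (x :+ :- y)) := x) ≈-refl (A ⊛ A) (q ⊛ σ₂ (κ ⊛ κ))))

  D : Series
  D = pow a 4 ⊕ ⊝ pow b 4

  σ₂-D : σ₂ D ≈ pow A 4 ⊕ ⊝ pow B 4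
  σ₂-D = ≈-trans (Sub₂.S-⊕ (pow a 4) (⊝ pow b 4)) (⊕-cong (Sub₂.S-pow a 4)
    (≈-trans (Sub₂.S-⊝ (pow b 4)) (⊝-cong (Sub₂.S-pow b 4))))

  -- With `A² = (a² + b²)/2` and `B² = ab`, `A⁴ - B⁴` is `((a² - b²)/2)²`. Multiplying by `A⁴` gives
  -- `D²/16`, and 16 is 1 modulo 5.
  D-square : D ⊛ D ≈ pow A 4 ⊛ σ₂ D
  D-square = ≈-sym (begin
    pow A 4 ⊛ σ₂ D
      ≈⟨ ⊛ˡ (pow A 4) σ₂-D ⟩
    pow A 4 ⊛ (pow A 4 ⊕ ⊝ pow B 4)
      ≈⟨ ⊛-cong (pow₄ A A²) (⊕-cong (pow₄ A A²) (⊝-cong (pow₄ B B²))) ⟩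
    (s ⊛ s) ⊛ (s ⊛ s ⊕ ⊝ ((a ⊛ b) ⊛ (a ⊛ b)))
      ≈⟨ solve 2 (λ a b → let s = con (+ 3) :* (a :* a :+ b :* b) in
           (s :* s) :* (s :* s :+ :- ((a :* b) :* (a :* b))) := (a :^ 4 :+ :- b :^ 4) :* (a :^ 4 :+ :- b :^ 4)) ≈-refl a b ⟩
    D ⊛ D ∎)
    where
    open ≈-Reasoning
    s = C (+ 3) ⊛ (a ⊛ a ⊕ b ⊛ b)

  open ThetaQuotient a (f 1) (f 2) (f 4) (fInv 2) (f-fInv 1) a-product (σ₂-f 0) (σ₂-f 1) public

  -- Jacobi's φ(q)⁴ - φ(-q)⁴ = 16 q ψ(q²)⁴
  D≈E : D ≈ E
  D≈E = difference-zero (⊛-σ₂-unique (D ⊕ E) (pow A 4) (D ⊕ ⊝ E) (+ 3)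
    -- `D` begins with `16 q` and `E` with `q`. So `D + E` begins with `17 q`, and 3 inverts 17
    -- modulo 5; below, `D - E` has the initial coefficients 0 and 15.
    (mod (Signed.divides (+ 0) refl)) (mod (Signed.divides (+ 10) refl))
    (begin
      (D ⊕ E) ⊛ (D ⊕ ⊝ E)
        ≈⟨ solve 2 (λ d e → (d :+ e) :* (d :+ :- e) := d :* d :+ :- (e :* e)) ≈-refl D E ⟩
      D ⊛ D ⊕ ⊝ (E ⊛ E)
        ≈⟨ ⊕-cong D-square (⊝-cong E-square) ⟩
      pow A 4 ⊛ σ₂ D ⊕ ⊝ (pow A 4 ⊛ σ₂ E)
        ≈⟨ solve 3 (λ a d e → a :* d :+ :- (a :* e) := a :* (d :+ :- e)) ≈-refl (pow A 4) (σ₂ D) (σ₂ E) ⟩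
      pow A 4 ⊛ (σ₂ D ⊕ ⊝ σ₂ E)
        ≈⟨ ⊛ˡ (pow A 4) (≈-trans (Sub₂.S-⊕ D (⊝ E)) (⊕ˡ (σ₂ D) (Sub₂.S-⊝ E))) ⟨
      pow A 4 ⊛ σ₂ (D ⊕ ⊝ E) ∎)
    (mod (Signed.divides (+ 0) refl)) (mod (Signed.divides (+ 3) refl)))
    where open ≈-Reasoning

-- b θa - a θb and -ab(a⁴ - b⁴) satisfy the same linear functional equation under q ↦ q², where (a², b²) moves by a step
-- of the arithmetic-geometric mean.
module Landen (a b : Series) (A² : σ₂ a ⊛ σ₂ a ≈ C (+ 3) ⊛ (a ⊛ a ⊕ b ⊛ b)) (B² : σ₂ b ⊛ σ₂ b ≈ a ⊛ b) where
  open ≈-Reasoning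

  A B D w : Series
  A = σ₂ a
  B = σ₂ b
  D = pow a 4 ⊕ ⊝ pow b 4
  w = b ⊛ θ a ⊕ ⊝ (a ⊛ θ b)

  θ-square-σ₂ : ∀ x → θ (σ₂ x ⊛ σ₂ x) ≈ C (+ 4) ⊛ (σ₂ x ⊛ σ₂ (θ x))
  θ-square-σ₂ x = begin
    θ (σ₂ x ⊛ σ₂ x)
      ≈⟨ θ-⊛ (σ₂ x) (σ₂ x) ⟩
    θ (σ₂ x) ⊛ σ₂ x ⊕ σ₂ x ⊛ θ (σ₂ x)
      ≈⟨ ⊕-cong (⊛ʳ (θ-σ₂ x) (σ₂ x)) (⊛ˡ (σ₂ x) (θ-σ₂ x)) ⟩
    (C (+ 2) ⊛ σ₂ (θ x)) ⊛ σ₂ x ⊕ σ₂ x ⊛ (C (+ 2) ⊛ σ₂ (θ x))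
      ≈⟨ solve 2 (λ y z → (con (+ 2) :* z) :* y :+ y :* (con (+ 2) :* z) := con (+ 4) :* (y :* z)) ≈-refl (σ₂ x) (σ₂ (θ x)) ⟩
    C (+ 4) ⊛ (σ₂ x ⊛ σ₂ (θ x)) ∎

  fourfold : ∀ {x y} → C (+ 4) ⊛ x ≈ y → x ≈ C (+ 4) ⊛ y
  fourfold {x} {y} e = ≈-trans (solve 1 (λ x → x := con (+ 4) :* (con (+ 4) :* x)) ≈-refl x) (⊛ˡ (C (+ 4)) e)

  A-σ₂θa : A ⊛ σ₂ (θ a) ≈ C (+ 4) ⊛ (a ⊛ θ a ⊕ b ⊛ θ b)
  A-σ₂θa = fourfold {A ⊛ σ₂ (θ a)} {a ⊛ θ a ⊕ b ⊛ θ b} (begin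
    C (+ 4) ⊛ (A ⊛ σ₂ (θ a))
      ≈⟨ θ-square-σ₂ a ⟨
    θ (A ⊛ A)
      ≈⟨ θ-cong (≈-trans A² (≈-sym (scale≈ (+ 3) (a ⊛ a ⊕ b ⊛ b)))) ⟩
    θ (scale (+ 3) (a ⊛ a ⊕ b ⊛ b))
      ≈⟨ ≈-trans (exactly (θ-scale (+ 3) (a ⊛ a ⊕ b ⊛ b))) (scale≈ (+ 3) (θ (a ⊛ a ⊕ b ⊛ b))) ⟩
    C (+ 3) ⊛ θ (a ⊛ a ⊕ b ⊛ b)
      ≈⟨ ⊛ˡ (C (+ 3)) (≈-trans (θ-⊕ (a ⊛ a) (b ⊛ b)) (⊕-cong (θ-⊛ a a) (θ-⊛ b b))) ⟩
    C (+ 3) ⊛ ((θ a ⊛ a ⊕ a ⊛ θ a) ⊕ (θ b ⊛ b ⊕ b ⊛ θ b))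
      ≈⟨ solve 4 (λ a b a′ b′ → con (+ 3) :* ((a′ :* a :+ a :* a′) :+ (b′ :* b :+ b :* b′)) := a :* a′ :+ b :* b′)
           ≈-refl a b (θ a) (θ b) ⟩
    a ⊛ θ a ⊕ b ⊛ θ b ∎)

  B-σ₂θb : B ⊛ σ₂ (θ b) ≈ C (+ 4) ⊛ (θ a ⊛ b ⊕ a ⊛ θ b)
  B-σ₂θb = fourfold {B ⊛ σ₂ (θ b)} {θ a ⊛ b ⊕ a ⊛ θ b} (begin
    C (+ 4) ⊛ (B ⊛ σ₂ (θ b))   ≈⟨ θ-square-σ₂ b ⟨
    θ (B ⊛ B)                  ≈⟨ θ-cong B² ⟩
    θ (a ⊛ b)                  ≈⟨ θ-⊛ a b ⟩
    θ a ⊛ b ⊕ a ⊛ θ b          ∎)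

  -- As 4 is -1 modulo 5, `d ≈ C (+ 0)` is the Wronskian formula `4 (b θa - a θb) = ab (a⁴ - b⁴)`.
  d : Series
  d = w ⊕ a ⊛ (b ⊛ D)

  σ₂-d : σ₂ d ≈ (B ⊛ σ₂ (θ a) ⊕ ⊝ (A ⊛ σ₂ (θ b))) ⊕ A ⊛ (B ⊛ (pow A 4 ⊕ ⊝ pow B 4))
  σ₂-d = ≈-trans (Sub₂.S-⊕ w (a ⊛ (b ⊛ D))) (⊕-cong
    (≈-trans (Sub₂.S-⊕ (b ⊛ θ a) (⊝ (a ⊛ θ b))) (⊕-cong (Sub₂.S-⊛ b (θ a))
      (≈-trans (Sub₂.S-⊝ (a ⊛ θ b)) (⊝-cong (Sub₂.S-⊛ a (θ b))))))
    (≈-trans (Sub₂.S-⊛ a (b ⊛ D)) (⊛ˡ A (≈-trans (Sub₂.S-⊛ b D) (⊛ˡ B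
      (≈-trans (Sub₂.S-⊕ (pow a 4) (⊝ pow b 4)) (⊕-cong (Sub₂.S-pow a 4)
        (≈-trans (Sub₂.S-⊝ (pow b 4)) (⊝-cong (Sub₂.S-pow b 4))))))))))

  -- The factor `AB` makes everything expressible through `A²`, `B²`, `A σ₂(θa)` and `B σ₂(θb)`, all
  -- known in terms of `a` and `b`. Over the rationals `AB` times `σ₂` of either summand of `d` is
  -- `(a² - b²)/8` times that summand; the 3 is 8 modulo 5.
  functional-equation : (a ⊛ a ⊕ ⊝ (b ⊛ b)) ⊛ d ≈ (C (+ 3) ⊛ (A ⊛ B)) ⊛ σ₂ d
  functional-equation = ≈-sym (begin
    (C (+ 3) ⊛ (A ⊛ B)) ⊛ σ₂ d
      ≈⟨ ⊛ˡ (C (+ 3) ⊛ (A ⊛ B)) σ₂-d ⟩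
    (C (+ 3) ⊛ (A ⊛ B)) ⊛ ((B ⊛ σ₂ (θ a) ⊕ ⊝ (A ⊛ σ₂ (θ b))) ⊕ A ⊛ (B ⊛ (pow A 4 ⊕ ⊝ pow B 4)))
      ≈⟨ solve 4 (λ A B A′ B′ → (con (+ 3) :* (A :* B)) :* ((B :* A′ :+ :- (A :* B′)) :+ A :* (B :* (A :^ 4 :+ :- B :^ 4))) :=
           con (+ 3) :* (((B :* B) :* (A :* A′) :+ :- ((A :* A) :* (B :* B′))) :+
             (A :* A) :* ((B :* B) :* ((A :* A) :* (A :* A) :+ :- ((B :* B) :* (B :* B)))))) ≈-refl A B (σ₂ (θ a)) (σ₂ (θ b)) ⟩
    C (+ 3) ⊛ (((B ⊛ B) ⊛ (A ⊛ σ₂ (θ a)) ⊕ ⊝ ((A ⊛ A) ⊛ (B ⊛ σ₂ (θ b)))) ⊕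
      (A ⊛ A) ⊛ ((B ⊛ B) ⊛ ((A ⊛ A) ⊛ (A ⊛ A) ⊕ ⊝ ((B ⊛ B) ⊛ (B ⊛ B)))))
      ≈⟨ ⊛ˡ (C (+ 3)) (⊕-cong (⊕-cong (⊛-cong B² A-σ₂θa) (⊝-cong (⊛-cong A² B-σ₂θb)))
           (⊛-cong A² (⊛-cong B² (⊕-cong (⊛-cong A² A²) (⊝-cong (⊛-cong B² B²)))))) ⟩
    C (+ 3) ⊛ (((a ⊛ b) ⊛ (C (+ 4) ⊛ (a ⊛ θ a ⊕ b ⊛ θ b)) ⊕ ⊝ (s ⊛ (C (+ 4) ⊛ (θ a ⊛ b ⊕ a ⊛ θ b)))) ⊕
      s ⊛ ((a ⊛ b) ⊛ (s ⊛ s ⊕ ⊝ ((a ⊛ b) ⊛ (a ⊛ b)))))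
      ≈⟨ solve 4 (λ a b a′ b′ → let s = con (+ 3) :* (a :* a :+ b :* b) in
           con (+ 3) :* (((a :* b) :* (con (+ 4) :* (a :* a′ :+ b :* b′)) :+ :- (s :* (con (+ 4) :* (a′ :* b :+ a :* b′)))) :+
             s :* ((a :* b) :* (s :* s :+ :- ((a :* b) :* (a :* b))))) :=
           (a :* a :+ :- (b :* b)) :* ((b :* a′ :+ :- (a :* b′)) :+ a :* (b :* (a :^ 4 :+ :- b :^ 4)))) ≈-refl a b (θ a) (θ b) ⟩
    (a ⊛ a ⊕ ⊝ (b ⊛ b)) ⊛ d ∎)
    where
    s = C (+ 3) ⊛ (a ⊛ a ⊕ b ⊛ b)

  X : Series
  X = a ⊛ D

  θ-fourth : ∀ x → θ (pow x 4) ≈ C (+ 4) ⊛ (pow x 3 ⊛ θ x)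
  θ-fourth x = begin
    θ (pow x 4)
      ≈⟨ θ-cong {pow x 4} {(x ⊛ x) ⊛ (x ⊛ x)} (solve 1 (λ x → x :^ 4 := (x :* x) :* (x :* x)) ≈-refl x) ⟩
    θ ((x ⊛ x) ⊛ (x ⊛ x))
      ≈⟨ θ-⊛ (x ⊛ x) (x ⊛ x) ⟩
    θ (x ⊛ x) ⊛ (x ⊛ x) ⊕ (x ⊛ x) ⊛ θ (x ⊛ x)
      ≈⟨ ⊕-cong (⊛ʳ (θ-⊛ x x) (x ⊛ x)) (⊛ˡ (x ⊛ x) (θ-⊛ x x)) ⟩
    (θ x ⊛ x ⊕ x ⊛ θ x) ⊛ (x ⊛ x) ⊕ (x ⊛ x) ⊛ (θ x ⊛ x ⊕ x ⊛ θ x)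
      ≈⟨ solve 2 (λ x t → (t :* x :+ x :* t) :* (x :* x) :+ (x :* x) :* (t :* x :+ x :* t) := con (+ 4) :* (x :^ 3 :* t)) ≈-refl x (θ x) ⟩
    C (+ 4) ⊛ (pow x 3 ⊛ θ x) ∎

  module _ (wronskian : d ≈ C (+ 0)) where

    -- This explains the choice of `X`: in `θ(a⁵ - a b⁴)` the term `5 a⁴ θa` disappears modulo 5 and
    -- `-b³ (b θa - a θb)` remains, to which the Wronskian formula applies.
    θ-X : θ X ≈ pow b 4 ⊛ X
    θ-X = begin
      θ (a ⊛ D)
        ≈⟨ θ-⊛ a D ⟩
      θ a ⊛ D ⊕ a ⊛ θ D
        ≈⟨ ⊕ˡ (θ a ⊛ D) (⊛ˡ a (≈-trans (θ-⊕ (pow a 4) (⊝ pow b 4)) (⊕-cong (θ-fourth a)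
             (≈-trans (θ-⊝ (pow b 4)) (⊝-cong (θ-fourth b)))))) ⟩
      θ a ⊛ D ⊕ a ⊛ (C (+ 4) ⊛ (pow a 3 ⊛ θ a) ⊕ ⊝ (C (+ 4) ⊛ (pow b 3 ⊛ θ b)))
        ≈⟨ solve 4 (λ a b a′ b′ →
             a′ :* (a :^ 4 :+ :- b :^ 4) :+ a :* (con (+ 4) :* (a :^ 3 :* a′) :+ :- (con (+ 4) :* (b :^ 3 :* b′))) :=
             b :^ 4 :* (a :* (a :^ 4 :+ :- b :^ 4)) :+
               :- (b :^ 3 :* ((b :* a′ :+ :- (a :* b′)) :+ a :* (b :* (a :^ 4 :+ :- b :^ 4))))) ≈-refl a b (θ a) (θ b) ⟩
      pow b 4 ⊛ X ⊕ ⊝ (pow b 3 ⊛ d)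
        ≈⟨ ⊕ˡ (pow b 4 ⊛ X) (⊝-cong (⊛ˡ (pow b 3) wronskian)) ⟩
      pow b 4 ⊛ X ⊕ ⊝ (pow b 3 ⊛ C (+ 0))
        ≈⟨ solve 2 (λ x y → x :+ :- (y :* con (+ 0)) := x) ≈-refl (pow b 4 ⊛ X) (pow b 3) ⟩
      pow b 4 ⊛ X ∎

    -- `X` has no constant term, so the logarithmic derivative is handled multiplied by `X`. Moved
    -- inside `U₅`, this factor becomes `X(q⁵) ≡ X⁵`, and `b⁴ X⁵` is `X⁴ θX`, to which `cartier`
    -- applies.
    U₅-b⁴-X : X ⊛ (U₅ (pow b 4) ⊕ ⊝ pow b 4) ≈ C (+ 0)
    U₅-b⁴-X = begin
      X ⊛ (U₅ (pow b 4) ⊕ ⊝ pow b 4)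
        ≈⟨ solve 3 (λ x u v → x :* (u :+ :- v) := u :* x :+ :- (v :* x)) ≈-refl X (U₅ (pow b 4)) (pow b 4) ⟩
      U₅ (pow b 4) ⊛ X ⊕ ⊝ (pow b 4 ⊛ X)
        ≈⟨ ⊕-cong (U₅-⊛-σ₅ (pow b 4) X) (⊝-cong θ-X) ⟨
      U₅ (pow b 4 ⊛ σ₅ X) ⊕ ⊝ θ X
        ≈⟨ ⊕ʳ (U₅-cong (⊛ˡ (pow b 4) (frobenius X))) (⊝ θ X) ⟨
      U₅ (pow b 4 ⊛ pow X 5) ⊕ ⊝ θ X
        ≈⟨ ⊕ʳ (U₅-cong {pow b 4 ⊛ pow X 5} {pow X 4 ⊛ (pow b 4 ⊛ X)}
             (solve 2 (λ x u → u :* x :^ 5 := x :^ 4 :* (u :* x)) ≈-refl X (pow b 4))) (⊝ θ X) ⟩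
      U₅ (pow X 4 ⊛ (pow b 4 ⊛ X)) ⊕ ⊝ θ X
        ≈⟨ ⊕ʳ (U₅-cong (⊛ˡ (pow X 4) θ-X)) (⊝ θ X) ⟨
      U₅ (pow X 4 ⊛ θ X) ⊕ ⊝ θ X
        ≈⟨ ⊕ʳ (cartier X) (⊝ θ X) ⟩
      θ X ⊕ ⊝ θ X
        ≈⟨ Ring.-‿inverseʳ (θ X) ⟩
      C (+ 0) ∎

module L = Landen Theta.a Theta.b Theta.A² Theta.B²

wronskian : L.d ≈ C (+ 0)
wronskian = ⊛-σ₂-unique (Theta.a ⊛ Theta.a ⊕ ⊝ (Theta.b ⊛ Theta.b)) (C (+ 3) ⊛ (L.A ⊛ L.B)) L.d (+ 2)
  -- `a² - b²` begins with `8 q`, and 2 inverts 8 modulo 5. The first coefficient of `d` is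
  -- `4 + 16 = 20`.
  (mod (Signed.divides (+ 0) refl)) (mod (Signed.divides (+ 3) refl)) L.functional-equation
  (mod (Signed.divides (+ 0) refl)) (mod (Signed.divides (+ 4) refl))

U₅-b⁴ : U₅ (pow Theta.b 4) ≈ pow Theta.b 4
U₅-b⁴ = difference-zero (⊛-cancel-zero L.X (U₅ (pow Theta.b 4) ⊕ ⊝ pow Theta.b 4) (+ 1)
  -- `X` begins with `16 q`, which is already `q` modulo 5.
  (mod (Signed.divides (+ 0) refl)) (mod (Signed.divides (+ 3) refl)) (L.U₅-b⁴-X wronskian))

-- The eta quotients and the overpartition function

shift≈ : ∀ k s → shift k s ≈ pow q k ⊛ s
shift≈ zero          s = ≈-sym (Ring.*-identityˡ s)
shift≈ (suc zero)    s = ≈-trans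
  (exactly {shift 1 s} {q ⊛ s} λ { zero → sym (q-⊛-zero s) ; (suc n) → sym (q-⊛-suc s n) })
  (⊛ʳ {q} {pow q 1} (≈-sym (Ring.*-identityʳ q)) s)
shift≈ (suc (suc k)) s = ≈-trans
  (exactly {shift (suc (suc k)) s} {q ⊛ shift (suc k) s}
    λ { zero → sym (q-⊛-zero (shift (suc k) s)) ; (suc n) → sym (q-⊛-suc (shift (suc k) s) n) })
  (≈-trans (⊛ˡ q (shift≈ (suc k) s)) (≈-sym (Ring.*-assoc q (pow q (suc k)) s)))

pow-cancelʳ : ∀ u v m n → u ⊛ v ≈ one → pow v (m ℕ.+ n) ⊛ pow u n ≈ pow v m
pow-cancelʳ u v m n e = ≈-trans (⊛ʳ (pow-+ v m n) (pow u n))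
  (≈-trans (solve 3 (λ a b c → (a :* b) :* c := a :* (c :* b)) ≈-refl (pow v m) (pow v n) (pow u n))
  (≈-trans (⊛ˡ (pow v m) (pow-inverse u v n e)) (Ring.*-identityʳ (pow v m))))

pow-cancelˡ : ∀ u v m n → u ⊛ v ≈ one → pow v m ⊛ pow u (m ℕ.+ n) ≈ pow u n
pow-cancelˡ u v m n e = ≈-trans (⊛ˡ (pow v m) (pow-+ u m n))
  (≈-trans (solve 3 (λ a b c → a :* (b :* c) := (b :* a) :* c) ≈-refl (pow v m) (pow u m) (pow u n))
  (≈-trans (⊛ʳ (pow-inverse u v m e) (pow u n)) (Ring.*-identityˡ (pow u n))))

-- With `a⁴ = f₂²⁰/(f₁⁸ f₄⁸)`, `b⁴ = f₁⁸/f₂⁴` and `E = q f₄⁸/f₂⁴`, multiplying `a⁴ = b⁴ + E` by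
-- `f₁⁸ f₂⁴ f₄⁸` clears all denominators.
jacobi : ∀ a b x y z E → a ⊛ (pow x 2 ⊛ pow z 2) ≈ pow y 5 → b ⊛ y ≈ x ⊛ x → E ⊛ pow y 4 ≈ q ⊛ pow z 8 →
  pow a 4 ⊕ ⊝ pow b 4 ≈ E → pow y 24 ≈ pow x 16 ⊛ pow z 8 ⊕ q ⊛ (pow x 8 ⊛ pow z 16)
jacobi a b x y z E a≈ b≈ E≈ D≈ = begin
  pow y 24
    ≈⟨ pow-+ y 20 4 ⟩
  pow y 20 ⊛ pow y 4
    ≈⟨ ⊛ʳ (pow-scale₄ a x y z a≈) (pow y 4) ⟨
  (pow a 4 ⊛ (pow x 8 ⊛ pow z 8)) ⊛ pow y 4
    ≈⟨ solve 5 (λ a b x y z → (a :* (x :* z)) :* y := (((b :* y) :* x) :* z) :+ (x :* z) :* ((a :+ :- b) :* y))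
         ≈-refl (pow a 4) (pow b 4) (pow x 8) (pow y 4) (pow z 8) ⟩
  ((pow b 4 ⊛ pow y 4) ⊛ pow x 8) ⊛ pow z 8 ⊕ (pow x 8 ⊛ pow z 8) ⊛ ((pow a 4 ⊕ ⊝ pow b 4) ⊛ pow y 4)
    ≈⟨ ⊕-cong (⊛ʳ (⊛ʳ b⁴ (pow x 8)) (pow z 8))
         (⊛ˡ (pow x 8 ⊛ pow z 8) (≈-trans (⊛ʳ D≈ (pow y 4)) E≈)) ⟩
  (pow x 8 ⊛ pow x 8) ⊛ pow z 8 ⊕ (pow x 8 ⊛ pow z 8) ⊛ (q ⊛ pow z 8)
    ≈⟨ ⊕ˡ ((pow x 8 ⊛ pow x 8) ⊛ pow z 8)
         (solve 3 (λ x z q → (x :* z) :* (q :* z) := q :* (x :* (z :* z))) ≈-refl (pow x 8) (pow z 8) q) ⟩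
  (pow x 8 ⊛ pow x 8) ⊛ pow z 8 ⊕ q ⊛ (pow x 8 ⊛ (pow z 8 ⊛ pow z 8))
    ≈⟨ ⊕-cong (⊛ʳ (pow-+ x 8 8) (pow z 8)) (⊛ˡ q (⊛ˡ (pow x 8) (pow-+ z 8 8))) ⟨
  pow x 16 ⊛ pow z 8 ⊕ q ⊛ (pow x 8 ⊛ pow z 16) ∎
  where
  open ≈-Reasoning
  b⁴ : pow b 4 ⊛ pow y 4 ≈ pow x 8
  b⁴ = ≈-trans (≈-sym (pow-⊛ b y 4)) (≈-trans (pow-cong 4 b≈) (≈-trans (pow-⊛ x x 4) (≈-sym (pow-+ x 4 4))))

-- The eta quotients as a quintic form

module EtaQuotients (x X y z Z : Series) (xX : x ⊛ X ≈ one) (zZ : z ⊛ Z ≈ one)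
  (relation : pow y 24 ≈ pow x 16 ⊛ pow z 8 ⊕ q ⊛ (pow x 8 ⊛ pow z 16)) where
  open ≈-Reasoning

  U T W : Series
  U = pow x 16 ⊛ pow z 8
  T = q ⊛ (pow x 8 ⊛ pow z 16)
  W = pow y 2 ⊛ (pow X 63 ⊛ pow Z 40)

  pow-U : ∀ s → pow U s ≈ pow x (s ℕ.* 16) ⊛ pow z (s ℕ.* 8)
  pow-U s = ≈-trans (pow-⊛ (pow x 16) (pow z 8) s) (⊛-cong (≈-sym (pow-* x 16 s)) (≈-sym (pow-* z 8 s)))

  pow-T : ∀ l → pow T l ≈ pow q l ⊛ (pow x (l ℕ.* 8) ⊛ pow z (l ℕ.* 16))
  pow-T l = ≈-trans (pow-⊛ q (pow x 8 ⊛ pow z 16) l) (⊛ˡ (pow q l) (≈-trans (pow-⊛ (pow x 8) (pow z 16) l)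
    (⊛-cong (≈-sym (pow-* x 8 l)) (≈-sym (pow-* z 16 l)))))

  -- A monomial in `U + T`, `U` and `T` times `W` is one eta quotient, because `U + T` is `y²⁴`. The
  -- series `u` and `v` stand for what remains of the powers of `x` and `z` after cancellation
  -- against `X⁶³` and `Z⁴⁰`.
  term : ∀ i s l {u v} → pow X 63 ⊛ pow x (s ℕ.* 16 ℕ.+ l ℕ.* 8) ≈ u → pow Z 40 ⊛ pow z (s ℕ.* 8 ℕ.+ l ℕ.* 16) ≈ v →
    pow q l ⊛ (pow y (i ℕ.* 24 ℕ.+ 2) ⊛ (u ⊛ v)) ≈ W ⊛ (pow (U ⊕ T) i ⊛ (pow U s ⊛ pow T l))
  term i s l {u} {v} u≈ v≈ = begin
    pow q l ⊛ (pow y (i ℕ.* 24 ℕ.+ 2) ⊛ (u ⊛ v))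
      ≈⟨ ⊛ˡ (pow q l) (⊛-cong
           (≈-trans (pow-+ y (i ℕ.* 24) 2) (⊛ʳ (≈-trans (pow-* y 24 i) (pow-cong i relation)) (pow y 2)))
           (⊛-cong
             (≈-trans (≈-sym u≈) (⊛ˡ (pow X 63) (pow-+ x (s ℕ.* 16) (l ℕ.* 8))))
             (≈-trans (≈-sym v≈) (⊛ˡ (pow Z 40) (pow-+ z (s ℕ.* 8) (l ℕ.* 16)))))) ⟩
    pow q l ⊛ ((pow (U ⊕ T) i ⊛ pow y 2) ⊛ ((pow X 63 ⊛ (xs ⊛ xl)) ⊛ (pow Z 40 ⊛ (zs ⊛ zl))))
      ≈⟨ solve 9 (λ q Y y X xs xl Z zs zl → q :* ((Y :* y) :* ((X :* (xs :* xl)) :* (Z :* (zs :* zl)))) :=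
           (y :* (X :* Z)) :* (Y :* ((xs :* zs) :* (q :* (xl :* zl))))) ≈-refl
           (pow q l) (pow (U ⊕ T) i) (pow y 2) (pow X 63) xs xl (pow Z 40) zs zl ⟩
    W ⊛ (pow (U ⊕ T) i ⊛ ((xs ⊛ zs) ⊛ (pow q l ⊛ (xl ⊛ zl))))
      ≈⟨ ⊛ˡ W (⊛ˡ (pow (U ⊕ T) i) (⊛-cong (pow-U s) (pow-T l))) ⟨
    W ⊛ (pow (U ⊕ T) i ⊛ (pow U s ⊛ pow T l)) ∎
    where
    xs = pow x (s ℕ.* 16)
    xl = pow x (l ℕ.* 8)
    zs = pow z (s ℕ.* 8)
    zl = pow z (l ℕ.* 16)

  permute₁₂₃ : ∀ l a b c {t} → l ⊛ (a ⊛ (b ⊛ c)) ≈ t → l ⊛ (a ⊛ b ⊛ c) ≈ t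
  permute₁₂₃ l a b c e = ≈-trans (⊛ˡ l (Ring.*-assoc a b c)) e

  permute₁₃₂ : ∀ l a b c {t} → l ⊛ (a ⊛ (c ⊛ b)) ≈ t → l ⊛ (a ⊛ b ⊛ c) ≈ t
  permute₁₃₂ l a b c e = ≈-trans (⊛ˡ l (≈-trans (Ring.*-assoc a b c) (⊛ˡ a (Ring.*-comm b c)))) e

  permute₂₁₃ : ∀ l a b c {t} → l ⊛ (b ⊛ (a ⊛ c)) ≈ t → l ⊛ (a ⊛ b ⊛ c) ≈ t
  permute₂₁₃ l a b c e = ≈-trans (⊛ˡ l (≈-trans (⊛ʳ (Ring.*-comm a b) c) (Ring.*-assoc b a c))) e

  scaled : ∀ k a b c {t} → one ⊛ (a ⊛ b ⊛ c) ≈ t → scale k (a ⊛ b ⊛ c) ≈ C k ⊛ t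
  scaled k a b c e = ≈-trans (scale≈ k (a ⊛ b ⊛ c)) (⊛ˡ (C k) (≈-trans (≈-sym (Ring.*-identityˡ (a ⊛ b ⊛ c))) e))

  scaled-shift : ∀ k l a b c {t} → pow q l ⊛ (a ⊛ b ⊛ c) ≈ t → scale k (shift l (a ⊛ b ⊛ c)) ≈ C k ⊛ t
  scaled-shift k l a b c e = ≈-trans (scale≈ k (shift l (a ⊛ b ⊛ c))) (⊛ˡ (C k) (≈-trans (shift≈ l (a ⊛ b ⊛ c)) e))

  quotients : Series
  quotients =
    scale (+ 2) (pow y 122 ⊛ pow X 63 ⊛ pow Z 40)
    ⊕ scale (+ 3) (x ⊛ pow y 26 ⊛ pow Z 8)
    ⊕ scale (+ 4) (shift 1 (pow y 98 ⊛ pow X 55 ⊛ pow Z 24))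
    ⊕ scale (+ 3) (shift 1 (pow x 9 ⊛ pow y 2 ⊛ pow z 8))
    ⊕ scale (+ 4) (shift 2 (pow y 74 ⊛ pow X 47 ⊛ pow Z 8))
    ⊕ scale (+ 4) (shift 3 (pow y 50 ⊛ pow z 8 ⊛ pow X 39))
    ⊕ scale (+ 4) (shift 4 (pow y 26 ⊛ pow z 24 ⊛ pow X 31))
    ⊕ scale (+ 2) (shift 5 (pow y 2 ⊛ pow z 40 ⊛ pow X 23))

  private
    -- For each quotient `i` is read off from the exponent `24 i + 2` of `y`, `l` from the power of
    -- `q`, and `s` from `i + s + l = 5`.
    V : ℕ → ℕ → ℕ → Series
    V i s l = pow (U ⊕ T) i ⊛ (pow U s ⊛ pow T l)

    t₁ : scale (+ 2) (pow y 122 ⊛ pow X 63 ⊛ pow Z 40) ≈ C (+ 2) ⊛ (W ⊛ V 5 0 0)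
    t₁ = scaled (+ 2) (pow y 122) (pow X 63) (pow Z 40) (permute₁₂₃ one (pow y 122) (pow X 63) (pow Z 40)
      (term 5 0 0 (pow-cancelʳ x X 63 0 xX) (pow-cancelʳ z Z 40 0 zZ)))

    t₂ : scale (+ 3) (x ⊛ pow y 26 ⊛ pow Z 8) ≈ C (+ 3) ⊛ (W ⊛ V 1 4 0)
    t₂ = scaled (+ 3) x (pow y 26) (pow Z 8) (permute₂₁₃ one x (pow y 26) (pow Z 8)
      (term 1 4 0 (≈-trans (pow-cancelˡ x X 63 1 xX) (Ring.*-identityʳ x)) (pow-cancelʳ z Z 8 32 zZ)))

    t₃ : scale (+ 4) (shift 1 (pow y 98 ⊛ pow X 55 ⊛ pow Z 24)) ≈ C (+ 4) ⊛ (W ⊛ V 4 0 1)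
    t₃ = scaled-shift (+ 4) 1 (pow y 98) (pow X 55) (pow Z 24) (permute₁₂₃ (pow q 1) (pow y 98) (pow X 55) (pow Z 24)
      (term 4 0 1 (pow-cancelʳ x X 55 8 xX) (pow-cancelʳ z Z 24 16 zZ)))

    t₄ : scale (+ 3) (shift 1 (pow x 9 ⊛ pow y 2 ⊛ pow z 8)) ≈ C (+ 3) ⊛ (W ⊛ V 0 4 1)
    t₄ = scaled-shift (+ 3) 1 (pow x 9) (pow y 2) (pow z 8) (permute₂₁₃ (pow q 1) (pow x 9) (pow y 2) (pow z 8)
      (term 0 4 1 (pow-cancelˡ x X 63 9 xX) (pow-cancelˡ z Z 40 8 zZ)))

    t₅ : scale (+ 4) (shift 2 (pow y 74 ⊛ pow X 47 ⊛ pow Z 8)) ≈ C (+ 4) ⊛ (W ⊛ V 3 0 2)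
    t₅ = scaled-shift (+ 4) 2 (pow y 74) (pow X 47) (pow Z 8) (permute₁₂₃ (pow q 2) (pow y 74) (pow X 47) (pow Z 8)
      (term 3 0 2 (pow-cancelʳ x X 47 16 xX) (pow-cancelʳ z Z 8 32 zZ)))

    t₆ : scale (+ 4) (shift 3 (pow y 50 ⊛ pow z 8 ⊛ pow X 39)) ≈ C (+ 4) ⊛ (W ⊛ V 2 0 3)
    t₆ = scaled-shift (+ 4) 3 (pow y 50) (pow z 8) (pow X 39) (permute₁₃₂ (pow q 3) (pow y 50) (pow z 8) (pow X 39)
      (term 2 0 3 (pow-cancelʳ x X 39 24 xX) (pow-cancelˡ z Z 40 8 zZ)))

    t₇ : scale (+ 4) (shift 4 (pow y 26 ⊛ pow z 24 ⊛ pow X 31)) ≈ C (+ 4) ⊛ (W ⊛ V 1 0 4)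
    t₇ = scaled-shift (+ 4) 4 (pow y 26) (pow z 24) (pow X 31) (permute₁₃₂ (pow q 4) (pow y 26) (pow z 24) (pow X 31)
      (term 1 0 4 (pow-cancelʳ x X 31 32 xX) (pow-cancelˡ z Z 40 24 zZ)))

    t₈ : scale (+ 2) (shift 5 (pow y 2 ⊛ pow z 40 ⊛ pow X 23)) ≈ C (+ 2) ⊛ (W ⊛ V 0 0 5)
    t₈ = scaled-shift (+ 2) 5 (pow y 2) (pow z 40) (pow X 23) (permute₁₃₂ (pow q 5) (pow y 2) (pow z 40) (pow X 23)
      (term 0 0 5 (pow-cancelʳ x X 23 40 xX) (pow-cancelˡ z Z 40 40 zZ)))

  -- With `Y = U + T`, the four terms with coefficient 4 sum to `4 T (U⁴ - T⁴)` and `2 Y⁵` is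
  -- `2 U⁵ + 2 T⁵`. The total is then `5 U⁵ + 10 U⁴ T`.
  quotients≈0 : quotients ≈ C (+ 0)
  quotients≈0 = ≈-trans
    (⊕-cong (⊕-cong (⊕-cong (⊕-cong (⊕-cong (⊕-cong (⊕-cong t₁ t₂) t₃) t₄) t₅) t₆) t₇) t₈)
    (solve 3 (λ W U T →
      let V = λ i s l → (U :+ T) :^ i :* (U :^ s :* T :^ l) in
      con (+ 2) :* (W :* V 5 0 0) :+ con (+ 3) :* (W :* V 1 4 0) :+ con (+ 4) :* (W :* V 4 0 1) :+ con (+ 3) :* (W :* V 0 4 1)
        :+ con (+ 4) :* (W :* V 3 0 2) :+ con (+ 4) :* (W :* V 2 0 3) :+ con (+ 4) :* (W :* V 1 0 4) :+ con (+ 2) :* (W :* V 0 0 5)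
      := con (+ 0)) ≈-refl W U T)

-- Vanishing coefficients of the cube of a theta series

module Cube (b A : Series) (L : Series) (dissection : b ≈ σ₂ A ⊕ ⊝ (q ⊛ σ₂ (σ₂ (σ₂ L)))) where
  M P R S : Series
  M = σ₂ (σ₂ L)
  P = A ⊛ (A ⊛ A) ⊕ C (+ 3) ⊛ (q ⊛ (A ⊛ (M ⊛ M)))
  R = A ⊛ (A ⊛ M)
  S = L ⊛ (L ⊛ L)

  σ₂-⊛³ : ∀ x y z → σ₂ (x ⊛ (y ⊛ z)) ≈ σ₂ x ⊛ (σ₂ y ⊛ σ₂ z)
  σ₂-⊛³ x y z = ≈-trans (Sub₂.S-⊛ x (y ⊛ z)) (⊛ˡ (σ₂ x) (Sub₂.S-⊛ y z))

  -- The binomial expansion sorted by residues of exponents: even ones in `σ₂ P`, then `q` times a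
  -- series in `q²`, then 3 modulo 8. The coefficient 2 is -3 modulo 5.
  cube : pow b 3 ≈ (σ₂ P ⊕ C (+ 2) ⊛ (q ⊛ σ₂ R)) ⊕ ⊝ (q ⊛ (q ⊛ (q ⊛ σ₂ (σ₂ (σ₂ S)))))
  cube = begin
    pow b 3
      ≈⟨ pow-cong 3 dissection ⟩
    pow (E ⊕ ⊝ (q ⊛ O)) 3
      ≈⟨ solve 3 (λ E q O → (E :+ :- (q :* O)) :^ 3 :=
           ((E :* (E :* E) :+ con (+ 3) :* ((q :* q :^ 1) :* (E :* (O :* O)))) :+ con (+ 2) :* (q :* (E :* (E :* O)))) :+
             :- (q :* (q :* (q :* (O :* (O :* O)))))) ≈-refl E q O ⟩
    ((E ⊛ (E ⊛ E) ⊕ C (+ 3) ⊛ ((q ⊛ pow q 1) ⊛ (E ⊛ (O ⊛ O)))) ⊕ C (+ 2) ⊛ (q ⊛ (E ⊛ (E ⊛ O)))) ⊕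
      ⊝ (q ⊛ (q ⊛ (q ⊛ (O ⊛ (O ⊛ O)))))
      ≈⟨ ⊕-cong (⊕-cong σ₂-P (⊛ˡ (C (+ 2)) (⊛ˡ q (σ₂-⊛³ A A M)))) (⊝-cong (⊛ˡ q (⊛ˡ q (⊛ˡ q σ₂-S)))) ⟨
    (σ₂ P ⊕ C (+ 2) ⊛ (q ⊛ σ₂ R)) ⊕ ⊝ (q ⊛ (q ⊛ (q ⊛ σ₂ (σ₂ (σ₂ S))))) ∎
    where
    open ≈-Reasoning
    E = σ₂ A
    O = σ₂ M
    σ₂-P : σ₂ P ≈ E ⊛ (E ⊛ E) ⊕ C (+ 3) ⊛ ((q ⊛ pow q 1) ⊛ (E ⊛ (O ⊛ O)))
    σ₂-P = ≈-trans (Sub₂.S-⊕ (A ⊛ (A ⊛ A)) (C (+ 3) ⊛ (q ⊛ (A ⊛ (M ⊛ M))))) (⊕-cong (σ₂-⊛³ A A A)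
      (≈-trans (Sub₂.S-C⊛ (+ 3) (q ⊛ (A ⊛ (M ⊛ M)))) (⊛ˡ (C (+ 3)) (≈-trans (Sub₂.S-⊛ q (A ⊛ (M ⊛ M)))
        (⊛-cong Sub₂.S-q (σ₂-⊛³ A M M))))))
    σ₂-S : σ₂ (σ₂ (σ₂ S)) ≈ O ⊛ (O ⊛ O)
    σ₂-S = ≈-trans (Sub₂.S-cong (≈-trans (Sub₂.S-cong (σ₂-⊛³ L L L)) (σ₂-⊛³ (σ₂ L) (σ₂ L) (σ₂ L)))) (σ₂-⊛³ M M M)

  module _ (A₁ : Series) (A≈ : A ≈ σ₂ A₁) where

    R≈ : R ≈ σ₂ (A₁ ⊛ (A₁ ⊛ σ₂ L))
    R≈ = ≈-trans (⊛-cong A≈ (⊛ʳ A≈ M)) (≈-sym (σ₂-⊛³ A₁ A₁ (σ₂ L)))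

    -- The nested index is `8n + 7`. It is odd, which excludes `P`; it is 3 modulo 4, whereas
    -- `q R(q²)` has exponents 1 modulo 4 because `R` is a series in `q²`; and it is not 3 modulo 8,
    -- which excludes the last term.
    vanish : ∀ n → pow b 3 (suc (suc (suc (n ℕ.* 2) ℕ.* 2) ℕ.* 2)) ~ + 0
    vanish n = ~-trans (coeff cube (suc (k ℕ.* 2)) _) (~-+ (~-+ (~-reflexive (σ₂-odd P k)) middle) (~-neg last))
      where
      j k : ℕ
      j = suc (n ℕ.* 2)
      k = suc (j ℕ.* 2)
      middle : (C (+ 2) ⊛ (q ⊛ σ₂ R)) (suc (k ℕ.* 2)) ~ + 0
      middle = ~-trans (~-reflexive (trans (C-⊛ (+ 2) (q ⊛ σ₂ R) (suc (k ℕ.* 2)))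
        (cong (+ 2 *_) (trans (q-⊛-suc (σ₂ R) (k ℕ.* 2)) (σ₂-even R k)))))
        (~-* (~-refl {+ 2}) (~-trans (coeff R≈ k _) (~-reflexive (σ₂-odd (A₁ ⊛ (A₁ ⊛ σ₂ L)) j))))
      last : (q ⊛ (q ⊛ (q ⊛ σ₂ (σ₂ (σ₂ S))))) (suc (k ℕ.* 2)) ~ + 0
      last = ~-reflexive (begin
        (q ⊛ (q ⊛ (q ⊛ σ₂ (σ₂ (σ₂ S))))) (suc (k ℕ.* 2))  ≡⟨ q-⊛-suc (q ⊛ (q ⊛ σ₂ (σ₂ (σ₂ S)))) (k ℕ.* 2) ⟩
        (q ⊛ (q ⊛ σ₂ (σ₂ (σ₂ S)))) (k ℕ.* 2)              ≡⟨ q-⊛-suc (q ⊛ σ₂ (σ₂ (σ₂ S))) (suc (j ℕ.* 2 ℕ.* 2)) ⟩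
        (q ⊛ σ₂ (σ₂ (σ₂ S))) (suc (j ℕ.* 2 ℕ.* 2))        ≡⟨ q-⊛-suc (σ₂ (σ₂ (σ₂ S))) (j ℕ.* 2 ℕ.* 2) ⟩
        σ₂ (σ₂ (σ₂ S)) (j ℕ.* 2 ℕ.* 2)                    ≡⟨ σ₂-even (σ₂ (σ₂ S)) (j ℕ.* 2) ⟩
        σ₂ (σ₂ S) (j ℕ.* 2)                               ≡⟨ σ₂-even (σ₂ S) j ⟩
        σ₂ S j                                            ≡⟨ σ₂-odd S n ⟩
        + 0                                               ∎)
        where open ≡-Reasoning

pbar-inverse : pbar ⊛ Theta.b ≈ one
pbar-inverse = generic (f 1) (fInv 1) (f 2) Theta.b (f-fInv 0) gauss
  where
  generic : ∀ x X y b → x ⊛ X ≈ one → b ⊛ y ≈ x ⊛ x → (y ⊛ pow X 2) ⊛ b ≈ one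
  generic x X y b xX b≈ = begin
    (y ⊛ pow X 2) ⊛ b
      ≈⟨ solve 3 (λ y X b → (y :* X :^ 2) :* b := (b :* y) :* (X :* X)) ≈-refl y X b ⟩
    (b ⊛ y) ⊛ (X ⊛ X)
      ≈⟨ ⊛ʳ b≈ (X ⊛ X) ⟩
    (x ⊛ x) ⊛ (X ⊛ X)
      ≈⟨ ⊛-inverse x X x X xX xX ⟩
    one ∎
    where open ≈-Reasoning

U₅-inverse : ∀ p b → p ⊛ b ≈ one → U₅ (pow b 4) ≈ pow b 4 → U₅ p ≈ pow b 3
U₅-inverse p b pb U≈ = begin
  U₅ p
    ≈⟨ U₅-cong p≈ ⟩
  U₅ (pow b 4 ⊛ pow p 5)
    ≈⟨ U₅-cong (⊛ˡ (pow b 4) (frobenius p)) ⟩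
  U₅ (pow b 4 ⊛ σ₅ p)
    ≈⟨ U₅-⊛-σ₅ (pow b 4) p ⟩
  U₅ (pow b 4) ⊛ p
    ≈⟨ ⊛ʳ U≈ p ⟩
  pow b 4 ⊛ p
    ≈⟨ solve 2 (λ b p → b :^ 4 :* p := b :^ 3 :* (p :* b)) ≈-refl b p ⟩
  pow b 3 ⊛ (p ⊛ b)
    ≈⟨ ≈-trans (⊛ˡ (pow b 3) pb) (Ring.*-identityʳ (pow b 3)) ⟩
  pow b 3 ∎
  where
  open ≈-Reasoning
  p≈ : p ≈ pow b 4 ⊛ pow p 5
  p≈ = begin
    p                         ≈⟨ Ring.*-identityʳ p ⟨
    p ⊛ one                   ≈⟨ ⊛ˡ p (pow-one 4) ⟨
    p ⊛ pow one 4             ≈⟨ ⊛ˡ p (pow-cong 4 pb) ⟨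
    p ⊛ pow (p ⊛ b) 4         ≈⟨ solve 2 (λ b p → p :* (p :* b) :^ 4 := b :^ 4 :* p :^ 5) ≈-refl b p ⟩
    pow b 4 ⊛ pow p 5         ∎

pbar-vanish : ∀ n → pbar (40 ℕ.* n ℕ.+ 35) ~ + 0
pbar-vanish n = subst (λ k → pbar k ~ + 0) (sym (index n))
  (~-trans (coeff (U₅-inverse pbar Theta.b pbar-inverse U₅-b⁴) (suc (suc (suc (n ℕ.* 2) ℕ.* 2) ℕ.* 2)) _)
    (Cube.vanish Theta.b Theta.A (C (+ 2) ⊛ ψ) Theta.b-dissection Theta.a ≈-refl n))
  where
  index : ∀ n → 40 ℕ.* n ℕ.+ 35 ≡ suc (suc (suc (n ℕ.* 2) ℕ.* 2) ℕ.* 2) ℕ.* 5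
  index = ℕ-Solver.solve-∀

open EtaQuotients (f 1) (fInv 1) (f 2) (f 4) (fInv 4) (f-fInv 0) (f-fInv 3)
  (jacobi Theta.a Theta.b (f 1) (f 2) (f 4) Theta.E Theta.a-product gauss Theta.E-denominator Theta.D≈E)

theorem2p3 : (n : ℕ) →
    + 5 ∣ (pbar (40 Data.Nat.* n Data.Nat.+ 35)
    - (scale (+ 2) (pow (f 2) 122 ⊛ pow (fInv 1) 63 ⊛ pow (fInv 4) 40)
    ⊕ scale (+ 3) (f 1 ⊛ pow (f 2) 26 ⊛ pow (fInv 4) 8)
    ⊕ scale (+ 4) (shift 1 (pow (f 2) 98 ⊛ pow (fInv 1) 55 ⊛ pow (fInv 4) 24))
    ⊕ scale (+ 3) (shift 1 (pow (f 1) 9 ⊛ pow (f 2) 2 ⊛ pow (f 4) 8))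
    ⊕ scale (+ 4) (shift 2 (pow (f 2) 74 ⊛ pow (fInv 1) 47 ⊛ pow (fInv 4) 8))
    ⊕ scale (+ 4) (shift 3 (pow (f 2) 50 ⊛ pow (f 4) 8 ⊛ pow (fInv 1) 39))
    ⊕ scale (+ 4) (shift 4 (pow (f 2) 26 ⊛ pow (f 4) 24 ⊛ pow (fInv 1) 31))
    ⊕ scale (+ 2) (shift 5 (pow (f 2) 2 ⊛ pow (f 4) 40 ⊛ pow (fInv 1) 23))) n)
theorem2p3 n = Signed.∣⇒∣ᵤ (divides-difference (~-trans (pbar-vanish n)
  (~-sym (~-trans (coeff quotients≈0 n _) (~-reflexive (C0≡0 n))))))
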